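{- Let $F$ be a field of characteristic $p>0$. Let $G$ be a locally pro-$p$ group which admits a profinite (i.e. compact) open subgroup $K$ such that the pair $(G,K)$ is fair, i.e. for every open subgroup $H\subset K$ there exists an open subgroup $H'\subsetneq H$ such that for all $g\in G$ the inclusion $$K\cap gH'g^{ -1}\subsetneq K\cap gHg^{ -1}$$ is strict. Then the category $\mathrm{Mod}_F(G)$ of smooth $F[G]$-modules has no nonzero projective objects.
   Context: A topological group $G$ is locally pro-$p$ if it has an open subgroup which is a pro-$p$ group in the induced topology (in particular $G$ is Hausdorff). A representation of $G$ on an $F$-vector space $V$ is smooth if every $v\in V$ has open stabilizer in $G$. $\mathrm{Mod}_F(G)$ is the abelian category of smooth $G$-representations on $F$-vector spaces, with $G$-equivariant $F$-linear maps as morphisms. Projective means projective in this abelian category. -}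

module Defs where

open import Algebra.Bundles using (Group; CommutativeRing)
open import Algebra.Definitions using (Invertible)
open import Algebra.Module.Bundles using (Module)
open import Algebra.Module.Morphism.Structures using (module ModuleMorphisms)
open import Data.Fin.Base using (Fin)
open import Data.List.Relation.Unary.Any using (Any)
open import Data.Nat.Base using (ℕ; _^_)
open import Data.Nat.Divisibility using (_∣_)
open import Data.Product.Base using (Σ; ∃; ∃-syntax; Σ-syntax; _×_; _,_; proj₁; proj₂)
open import Data.Unit.Polymorphic using (⊤; tt)
open import Function.Base using (_∘_; _∘′_; id)
open import Function.Bundles using (_⇔_; Bijection)
open import Level using (Level; _⊔_; suc)
open import Relation.Binary.Bundles using (Setoid)
open import Relation.Binary.Core using (Rel)
open import Relation.Binary.Definitions using (_Respects_)
open import Relation.Binary.PropositionalEquality.Properties using () renaming (setoid to ≡-setoid)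
open import Relation.Nullary.Negation.Core using (¬_)
open import Relation.Unary using (Pred; _∈_; _⊆_; _⊂_; _≐_; _∩_; ⋃)
import Algebra.Definitions.RawMonoid as Multiple
import Algebra.Properties.Group as GroupProperties
import Relation.Binary.Reasoning.Setoid as SetoidReasoning

record IsField {c ℓ} (R : CommutativeRing c ℓ) : Set (c ⊔ ℓ) where
  open CommutativeRing R
  field
    1≉0           : ¬ (1# ≈ 0#)
    ≉0⇒invertible : ∀ x → ¬ (x ≈ 0#) → Invertible _≈_ 1# _*_ x

-- The kernel of the canonical map ℤ → R is nℤ; n = 0 is allowed.
HasCharacteristic : ∀ {c ℓ} → CommutativeRing c ℓ → ℕ → Set ℓ
HasCharacteristic R n = ∀ m → (m · 1# ≈ 0#) ⇔ (n ∣ m)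
  where
  open CommutativeRing R
  open Multiple +-rawMonoid using () renaming (_×_ to _·_)

-- Subsets live at the level of the carrier, and so do the index types of
-- unions and covers.  The level o of openness is free because the subspace
-- topology below raises it.
record IsTopology {ℓ o} (S : Setoid ℓ ℓ)
                  (Open : Pred (Pred (Setoid.Carrier S) ℓ) o) : Set (suc ℓ ⊔ o) where
  open Setoid S
  field
    open-resp-≐ : Open Respects _≐_
    -- An open set is a subset of the set presented by the setoid.
    open⇒resp-≈ : ∀ {U} → Open U → U Respects _≈_
    open-⊤      : Open (λ _ → ⊤)
    open-∩      : ∀ {U W} → Open U → Open W → Open (U ∩ W)
    open-⋃      : ∀ {I : Set ℓ} (U : I → Pred Carrier ℓ) →
                  (∀ i → Open (U i)) → Open (⋃ I U)

record TopologicalGroup (ℓ o : Level) : Set (suc (ℓ ⊔ o)) where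
  field
    group : Group ℓ ℓ
  open Group group public
  field
    Open         : Pred (Pred Carrier ℓ) o
    isTopology   : IsTopology setoid Open
    -- The sets A × B are a base of the product topology, so this is joint continuity.
    ∙-continuous : ∀ {U} → Open U → ∀ x y → (x ∙ y) ∈ U →
                   ∃[ A ] ∃[ B ] Open A × Open B × x ∈ A × y ∈ B ×
                     (∀ {a b} → a ∈ A → b ∈ B → (a ∙ b) ∈ U)
    ⁻¹-continuous : ∀ {U} → Open U → Open (λ x → (x ⁻¹) ∈ U)
  open IsTopology isTopology public

record Subgroup {ℓ} (G : Group ℓ ℓ) : Set (suc ℓ) where
  open Group G
  field
    Mem       : Pred Carrier ℓ
    resp-≈    : Mem Respects _≈_
    ε-closed  : ε ∈ Mem
    ∙-closed  : ∀ {x y} → x ∈ Mem → y ∈ Mem → (x ∙ y) ∈ Mem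
    ⁻¹-closed : ∀ {x} → x ∈ Mem → (x ⁻¹) ∈ Mem

open Subgroup public using (Mem)

module _ {ℓ} {G : Group ℓ ℓ} where
  open Group G

  IsNormal : Subgroup G → Set ℓ
  IsNormal N = ∀ g {n} → n ∈ Mem N → (g ∙ n ∙ g ⁻¹) ∈ Mem N

  Conj : Carrier → Subgroup G → Pred Carrier ℓ
  Conj g H x = ∃[ h ] h ∈ Mem H × x ≈ g ∙ h ∙ g ⁻¹

  leftCosets : Subgroup G → Setoid ℓ ℓ
  leftCosets H = record
    { Carrier       = Carrier
    ; _≈_           = λ x y → (x ⁻¹ ∙ y) ∈ Mem H
    ; isEquivalence = record
      { refl  = λ {x} → resp-≈ (sym (inverseˡ x)) ε-closed
      ; sym   = λ {x} {y} p → resp-≈ (flip x y) (⁻¹-closed p)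
      ; trans = λ {x} {y} {z} p q → resp-≈ (cancel x y z) (∙-closed p q)
      }
    }
    where
    open Subgroup H hiding (Mem)
    open GroupProperties G
    open SetoidReasoning setoid
    flip : ∀ x y → (x ⁻¹ ∙ y) ⁻¹ ≈ y ⁻¹ ∙ x
    flip x y = begin
      (x ⁻¹ ∙ y) ⁻¹    ≈⟨ ⁻¹-anti-homo-∙ (x ⁻¹) y ⟩
      y ⁻¹ ∙ x ⁻¹ ⁻¹   ≈⟨ ∙-congˡ (⁻¹-involutive x) ⟩
      y ⁻¹ ∙ x         ∎
    cancel : ∀ x y z → (x ⁻¹ ∙ y) ∙ (y ⁻¹ ∙ z) ≈ x ⁻¹ ∙ z
    cancel x y z = begin
      (x ⁻¹ ∙ y) ∙ (y ⁻¹ ∙ z)   ≈⟨ assoc (x ⁻¹) y (y ⁻¹ ∙ z) ⟩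
      x ⁻¹ ∙ (y ∙ (y ⁻¹ ∙ z))   ≈⟨ ∙-congˡ (assoc y (y ⁻¹) z) ⟨
      x ⁻¹ ∙ ((y ∙ y ⁻¹) ∙ z)   ≈⟨ ∙-congˡ (∙-congʳ (inverseʳ y)) ⟩
      x ⁻¹ ∙ (ε ∙ z)            ≈⟨ ∙-congˡ (identityˡ z) ⟩
      x ⁻¹ ∙ z                  ∎

  HasIndex : Subgroup G → ℕ → Set ℓ
  HasIndex H n = Bijection (leftCosets H) (≡-setoid (Fin n))

  subgroup⇒group : Subgroup G → Group ℓ ℓ
  subgroup⇒group H = record
    { Carrier = Σ Carrier (Mem H)
    ; _≈_     = λ x y → proj₁ x ≈ proj₁ y
    ; _∙_     = λ x y → proj₁ x ∙ proj₁ y , ∙-closed (proj₂ x) (proj₂ y)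
    ; ε       = ε , ε-closed
    ; _⁻¹     = λ x → proj₁ x ⁻¹ , ⁻¹-closed (proj₂ x)
    ; isGroup = record
      { isMonoid = record
        { isSemigroup = record
          { isMagma = record
            { isEquivalence = record { refl = refl ; sym = sym ; trans = trans }
            ; ∙-cong        = ∙-cong
            }
          ; assoc = λ x y z → assoc (proj₁ x) (proj₁ y) (proj₁ z)
          }
        ; identity = (identityˡ ∘ proj₁) , (identityʳ ∘ proj₁)
        }
      ; inverse = (inverseˡ ∘ proj₁) , (inverseʳ ∘ proj₁)
      ; ⁻¹-cong = ⁻¹-cong
      }
    }
    where open Subgroup H hiding (Mem)

module _ {ℓ o} (G : TopologicalGroup ℓ o) where
  open TopologicalGroup G

  induced : Subgroup group → TopologicalGroup ℓ (suc ℓ ⊔ o)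
  induced H = record
    { group         = subgroup⇒group H
    ; Open          = λ W → ∃[ U ] Open U × W ≐ (U ∘ proj₁)
    ; isTopology    = record
      { open-resp-≐ = λ { (f , g) (U , oU , (s , t)) →
          U , oU , ((λ w → s (g w)) , λ u → f (t u)) }
      ; open⇒resp-≈ = λ { (U , oU , (s , t)) e w → t (open⇒resp-≈ oU e (s w)) }
      ; open-⊤      = (λ _ → ⊤) , open-⊤ , ((λ _ → tt) , λ _ → tt)
      ; open-∩      = λ { (U , oU , (s , t)) (U′ , oU′ , (s′ , t′)) →
          U ∩ U′ , open-∩ oU oU′ ,
          ((λ (w , w′) → s w , s′ w′) , λ (u , u′) → t u , t′ u′) }
      ; open-⋃      = λ W oW →
          ⋃ _ (λ i → proj₁ (oW i)) ,
          open-⋃ _ (λ i → proj₁ (proj₂ (oW i))) ,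
          ((λ (i , w) → i , proj₁ (proj₂ (proj₂ (oW i))) w) ,
            λ (i , u) → i , proj₂ (proj₂ (proj₂ (oW i))) u)
      }
    ; ∙-continuous  = λ { (U , oU , (s , t)) x y m →
        let A , B , oA , oB , a , b , f = ∙-continuous oU (proj₁ x) (proj₁ y) (s m)
        in A ∘ proj₁ , B ∘ proj₁ ,
           (A , oA , id , id) , (B , oB , id , id) , a , b , λ p q → t (f p q) }
    ; ⁻¹-continuous = λ { (U , oU , (s , t)) → _ , ⁻¹-continuous oU , (s , t) }
    }

  IsCompact : Set (suc ℓ ⊔ o)
  IsCompact = ∀ {I : Set ℓ} (U : I → Pred Carrier ℓ) → (∀ i → Open (U i)) →
              (∀ x → ∃[ i ] x ∈ U i) →
              ∃[ is ] (∀ x → Any (λ i → x ∈ U i) is)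

  IsHausdorff : Set (suc ℓ ⊔ o)
  IsHausdorff = ∀ x y → ¬ (x ≈ y) →
                ∃[ U ] ∃[ W ] Open U × Open W × x ∈ U × y ∈ W ×
                  (∀ z → ¬ (z ∈ U × z ∈ W))

  record IsProfinite : Set (suc ℓ ⊔ o) where
    field
      compact   : IsCompact
      hausdorff : IsHausdorff
      open-subgroup-base : ∀ {U} → Open U → ε ∈ U →
                           Σ[ H ∈ Subgroup group ] Open (Mem H) × Mem H ⊆ U

  record IsProP (p : ℕ) : Set (suc ℓ ⊔ o) where
    field
      isProfinite   : IsProfinite
      p-power-index : ∀ (N : Subgroup group) → Open (Mem N) → IsNormal N →
                      ∃[ n ] HasIndex N (p ^ n)

module _ {ℓ o} (G : TopologicalGroup ℓ o) where
  open TopologicalGroup G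

  IsLocallyProP : ℕ → Set (suc ℓ ⊔ o)
  IsLocallyProP p = Σ[ U ∈ Subgroup group ] Open (Mem U) × IsProP (induced G U) p

  -- P ⊂ Q in Relation.Unary is strict inclusion: P ⊆ Q and not Q ⊆ P.
  IsFair : Subgroup group → Set (suc ℓ ⊔ o)
  IsFair K = ∀ (H : Subgroup group) → Open (Mem H) → Mem H ⊆ Mem K →
             Σ[ H′ ∈ Subgroup group ] Open (Mem H′) × Mem H′ ⊂ Mem H ×
               (∀ g → (Mem K ∩ Conj g H′) ⊂ (Mem K ∩ Conj g H))

module _ {ℓ o} (F : CommutativeRing ℓ ℓ) (G : TopologicalGroup ℓ o) where
  private
    module G = TopologicalGroup G
  open G using (_∙_; ε; _⁻¹)

  record SmoothRep : Set (suc ℓ ⊔ o) where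
    infixr 7 _·_
    field
      V : Module F ℓ ℓ
    open Module V public
    field
      _·_      : G.Carrier → Carrierᴹ → Carrierᴹ
      ·-congʳ  : ∀ {g h} v → g G.≈ h → g · v ≈ᴹ h · v
      ·-linear : ∀ g → ModuleMorphisms.IsModuleHomomorphism rawModule rawModule (g ·_)
      ε-·      : ∀ v → ε · v ≈ᴹ v
      ∙-·      : ∀ g h v → (g ∙ h) · v ≈ᴹ g · h · v
      smooth   : ∀ v → G.Open (λ g → g · v ≈ᴹ v)

  record Hom (M N : SmoothRep) : Set ℓ where
    private
      module M = SmoothRep M
      module N = SmoothRep N
    field
      ⟦_⟧         : M.Carrierᴹ → N.Carrierᴹ
      linear      : ModuleMorphisms.IsModuleHomomorphism M.rawModule N.rawModule ⟦_⟧
      equivariant : ∀ g v → ⟦ g M.· v ⟧ N.≈ᴹ g N.· ⟦ v ⟧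

  module _ {M N : SmoothRep} where
    open SmoothRep N using (_≈ᴹ_)
    open Hom

    infix 4 _≗ₕ_
    _≗ₕ_ : Rel (Hom M N) ℓ
    f ≗ₕ g = ∀ v → ⟦ f ⟧ v ≈ᴹ ⟦ g ⟧ v

  infixr 9 _∘ₕ_
  _∘ₕ_ : ∀ {L M N} → Hom M N → Hom L M → Hom L N
  _∘ₕ_ {L} {M} {N} g f = record
    { ⟦_⟧         = g.⟦_⟧ ∘′ f.⟦_⟧
    ; linear      = ∘-linear N.≈ᴹ-trans f.linear g.linear
    ; equivariant = λ x v → N.≈ᴹ-trans (GL.⟦⟧-cong (f.equivariant x v)) (g.equivariant x f.⟦ v ⟧)
    }
    where
    open import Algebra.Module.Morphism.Construct.Composition
      using () renaming (isModuleHomomorphism to ∘-linear)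
    module N = SmoothRep N
    module f = Hom f
    module g = Hom g
    module GL = ModuleMorphisms.IsModuleHomomorphism g.linear

  -- Both notions are the categorical ones; objects are compared in one universe.
  IsEpi : ∀ {M N} → Hom M N → Set (suc ℓ ⊔ o)
  IsEpi {M} {N} e = ∀ {Q} (f g : Hom N Q) → (f ∘ₕ e) ≗ₕ (g ∘ₕ e) → f ≗ₕ g

  IsProjective : SmoothRep → Set (suc ℓ ⊔ o)
  IsProjective P = ∀ {M N} (e : Hom M N) → IsEpi e → (f : Hom P N) →
                   Σ[ f̃ ∈ Hom P M ] (e ∘ₕ f̃) ≗ₕ f

  IsNonzero : SmoothRep → Set ℓ
  IsNonzero M = ∃[ v ] ¬ (v ≈ᴹ 0ᴹ)
    where open SmoothRep M

{-# OPTIONS --safe #-}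
-- Let v₀ be a vector of a projective P, U open pro-p, and J = U ∩ K ∩ Stab(v₀).  By iterating
-- fairness, every open H ⊆ K contains an open H′ with J ∩ g H′ g⁻¹ ≠ J ∩ g H g⁻¹ for all g.
-- Taking H = K ∩ Stab(w) for each w ∈ P, the map ⨁_w F[G/H′] → P, g H′ ↦ g w, is epi, so it has
-- a section s, and s(v₀) is J-invariant.  Its coefficients are constant on J-orbits, and the
-- J-orbit of g H′ maps to [J ∩ g H g⁻¹ : J ∩ g H′ g⁻¹] times an element of P.  That index is a
-- power of p other than 1, so v₀ = 0.
--
-- The goal being a negation, decisions of membership and of equality are available under ¬¬,
-- but only finitely many at a time.
module Submission where

open import Defs
open import Algebra.Bundles using (CommutativeMonoid; CommutativeRing; Group)
open import Algebra.Module.Bundles using (Module)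
open import Algebra.Module.Morphism.Structures using (module ModuleMorphisms)
open import Algebra.Module.Structures.Biased using (IsModuleFromLeft)
open import Data.Empty using (⊥)
open import Data.Fin.Base as Fin using (Fin; zero; suc; toℕ; combine; quotRem; remQuot; splitAt)
open import Data.Fin.Properties
  using (_≟_; cantor-schröder-bernstein; combine-remQuot; pigeonhole; remQuot-combine; toℕ<n)
open import Data.List.Base using (List; []; _∷_; _++_; length; lookup; map)
open import Data.List.Membership.Propositional using () renaming (_∈_ to _∈ₗ_)
open import Data.List.Membership.Propositional.Properties using (∈-++⁺ˡ; ∈-++⁺ʳ)
open import Data.List.Relation.Unary.Any as Any using (Any; here; there)
import Data.List.Relation.Unary.Any.Properties as Any
open import Data.Nat.Base
  using (ℕ; zero; suc; _*_; _^_; _<_; _≤_; z≤n; _≤′_; ≤′-refl; ≤′-step;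
         nonTrivial⇒n>1; nonTrivial⇒nonZero)
open import Data.Nat.Coprimality using (Coprime; coprime-divisor)
open import Data.Nat.Divisibility
  using (_∣_; _∣?_; divides; >⇒∤; m∣m*n; n∣m*n; ∣1⇒≡1; ∣-refl; ∣-trans)
open import Data.Nat.Primality using (Composite; Prime; composite; prime; prime⇒irreducible)
open import Data.Nat.Properties using (m<m*n; n<1+n; ≤⇒≤′)
open import Data.Product.Base
  using (Σ; Σ-syntax; ∃-syntax; _×_; _,_; map₁; map₂; proj₁; proj₂; swap)
open import Data.Sum.Base as Sum⊎ using (_⊎_; inj₁; inj₂; [_,_]′)
open import Data.Unit.Polymorphic using (⊤; tt)
open import Function.Base using (_∘_; case_of_; id)
open import Function.Bundles using (Bijection; Equivalence)
open import Level using (Level; _⊔_)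
open import Relation.Binary.Bundles using (Setoid)
open import Relation.Binary.PropositionalEquality as ≡ using (_≡_; _≢_)
open import Relation.Nullary.Decidable.Core using (Dec; yes; no; map′; ¬¬-excluded-middle)
open import Relation.Nullary.Negation.Core using (¬_; contradiction)
open import Relation.Unary using (Pred; _∈_; _⊆_)
import Algebra.Definitions.RawMonoid as Multiple
import Algebra.Properties.CommutativeMonoid.Sum as Sum
import Algebra.Properties.CommutativeSemigroup as CommutativeSemigroupProperties
import Algebra.Properties.Group as GroupProperties
import Relation.Binary.Reasoning.Setoid as SetoidReasoning

-- The pro-p condition speaks only of open normal subgroups of U, and fairness only of intersections
-- with K, while the orbit sums need indices between subgroups of J. Normal cores close the first
-- gap; shrinking H more often than J has cosets in K closes the second. As H fixes w, the vector g
-- w depends only on g H. Passing from H to H′ therefore multiplies the points of a J-orbit without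
-- producing new images, and this multiplicity is what dies in characteristic p. The direct sum is
-- indexed by all of P, so that w is visibly the image of the coset H′ in the summand w; it also
-- stays in the universe of P, as `IsProjective` requires. Equality of cosets is undecidable, so
-- coefficients are not functions on the free module. The argument works on terms instead, removing
-- one J-orbit at a time from the finitely many basis elements written in s(v₀).

private
  variable
    α β : Level
    A : Set α
    B : Set β

-- The double-negation monad

pure : A → ¬ ¬ A
pure x k = k x

infixl 1 _>>=_
_>>=_ : ¬ ¬ A → (A → ¬ ¬ B) → ¬ ¬ B
(m >>= f) k = m λ x → f x k

-- Finiteness is essential: for an infinite family this would be double-negation shift, which is not
-- constructively provable.
¬¬-sequence : ∀ {n} {P : Fin n → Set α} → (∀ i → ¬ ¬ P i) → ¬ ¬ (∀ i → P i)
¬¬-sequence {n = zero}  f = pure λ ()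
¬¬-sequence {n = suc n} f = do
  p  ← f zero
  ps ← ¬¬-sequence (f ∘ suc)
  pure λ { zero → p ; (suc i) → ps i }

-- Cosets and indices

module Cosets {ℓ} (G : Group ℓ ℓ) where
  open Group G
  open GroupProperties G

  infix 4 _∼[_]_
  _∼[_]_ : Carrier → Subgroup G → Carrier → Set ℓ
  x ∼[ H ] y = Setoid._≈_ (leftCosets H) x y

  module _ (H : Subgroup G) where
    open Subgroup H using (resp-≈; ε-closed; ∙-closed; ⁻¹-closed)
    open Setoid (leftCosets H) public
      using () renaming (refl to ∼-refl; sym to ∼-sym; trans to ∼-trans)

    ≈⇒∼ : ∀ {x y} → x ≈ y → x ∼[ H ] y
    ≈⇒∼ {x} x≈y = resp-≈ (trans (sym (inverseˡ x)) (∙-congˡ x≈y)) ε-closed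

    ∙-∼ : ∀ z {x y} → x ∼[ H ] y → z ∙ x ∼[ H ] z ∙ y
    ∙-∼ z {x} {y} = resp-≈ (begin
      x ⁻¹ ∙ y                   ≈⟨ ∙-congˡ (\\-leftDividesʳ z y) ⟨
      x ⁻¹ ∙ (z ⁻¹ ∙ (z ∙ y))    ≈⟨ assoc _ _ _ ⟨
      (x ⁻¹ ∙ z ⁻¹) ∙ (z ∙ y)    ≈⟨ ∙-congʳ (⁻¹-anti-homo-∙ z x) ⟨
      (z ∙ x) ⁻¹ ∙ (z ∙ y)       ∎)
      where open import Relation.Binary.Reasoning.Setoid setoid

    ∙-∼-cancel : ∀ z {x y} → z ∙ x ∼[ H ] z ∙ y → x ∼[ H ] y
    ∙-∼-cancel z {x} {y} p = ∼-trans (≈⇒∼ (sym (\\-leftDividesʳ z x)))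
      (∼-trans (∙-∼ (z ⁻¹) p) (≈⇒∼ (\\-leftDividesʳ z y)))

    ∼∙ : ∀ x {h} → h ∈ Mem H → x ∼[ H ] x ∙ h
    ∼∙ x = resp-≈ (sym (\\-leftDividesʳ x _))

    ∈-resp-∼ : ∀ {x y} → x ∼[ H ] y → x ∈ Mem H → y ∈ Mem H
    ∈-resp-∼ {x} x∼y x∈H = resp-≈ (\\-leftDividesˡ x _) (∙-closed x∈H x∼y)

    ∈⇒∼ : ∀ {x y} → x ∈ Mem H → y ∈ Mem H → x ∼[ H ] y
    ∈⇒∼ x∈H y∈H = ∙-closed (⁻¹-closed x∈H) y∈H

    ε∼⇒∈ : ∀ {x} → ε ∼[ H ] x → x ∈ Mem H
    ε∼⇒∈ p = ∈-resp-∼ p ε-closed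

  infixr 7 _⊓_
  _⊓_ : Subgroup G → Subgroup G → Subgroup G
  A ⊓ B = record
    { Mem       = λ x → x ∈ Mem A × x ∈ Mem B
    ; resp-≈    = λ e (a , b) → A.resp-≈ e a , B.resp-≈ e b
    ; ε-closed  = A.ε-closed , B.ε-closed
    ; ∙-closed  = λ (a , b) (a′ , b′) → A.∙-closed a a′ , B.∙-closed b b′
    ; ⁻¹-closed = λ (a , b) → A.⁻¹-closed a , B.⁻¹-closed b
    }
    where
    module A = Subgroup A
    module B = Subgroup B

  -- The stabiliser g H g⁻¹ of the coset g H.
  stab : Subgroup G → Carrier → Subgroup G
  stab H g = record
    { Mem       = λ x → g ∼[ H ] x ∙ g
    ; resp-≈    = λ e p → ∼-trans H p (≈⇒∼ H (∙-congʳ e))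
    ; ε-closed  = ≈⇒∼ H (sym (identityˡ g))
    ; ∙-closed  = λ {x} {y} p q → ∼-trans H p
        (∼-trans H (∙-∼ H x q) (≈⇒∼ H (sym (assoc x y g))))
    ; ⁻¹-closed = λ {x} p → ∼-sym H
        (∼-trans H (∙-∼ H (x ⁻¹) p) (≈⇒∼ H (\\-leftDividesʳ x g)))
    }

  Conj⇒stab : ∀ H g {x} → x ∈ Conj g H → x ∈ Mem (stab H g)
  Conj⇒stab H g {x} (h , h∈H , x≈ghg⁻¹) = ∼-trans H (∼∙ H g h∈H) (≈⇒∼ H (begin
    g ∙ h                ≈⟨ //-rightDividesˡ g (g ∙ h) ⟨
    g ∙ h ∙ g ⁻¹ ∙ g     ≈⟨ ∙-congʳ x≈ghg⁻¹ ⟨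
    x ∙ g                ∎))
    where open import Relation.Binary.Reasoning.Setoid setoid

  stab⇒Conj : ∀ H g {x} → x ∈ Mem (stab H g) → x ∈ Conj g H
  stab⇒Conj H g {x} p = g ⁻¹ ∙ (x ∙ g) , p , (begin
    x                              ≈⟨ //-rightDividesʳ g x ⟨
    x ∙ g ∙ g ⁻¹                   ≈⟨ ∙-congʳ (\\-leftDividesˡ g (x ∙ g)) ⟨
    g ∙ (g ⁻¹ ∙ (x ∙ g)) ∙ g ⁻¹    ∎)
    where open import Relation.Binary.Reasoning.Setoid setoid

  -- Orbit-stabiliser, with the converse in `stab-∼⁻`: cosets of `stab H g` correspond to points x g
  -- H, so a transversal modulo `stab H g` lists an orbit without repetition.
  stab-∼⁺ : ∀ H g {x y} → x ∼[ stab H g ] y → x ∙ g ∼[ H ] y ∙ g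
  stab-∼⁺ H g {x} {y} p = ∼-trans H (∙-∼ H x p)
    (≈⇒∼ H (trans (sym (assoc _ _ _)) (∙-congʳ (\\-leftDividesˡ x y))))

  stab-∼⁻ : ∀ H g {x y} → x ∙ g ∼[ H ] y ∙ g → x ∼[ stab H g ] y
  stab-∼⁻ H g {x} {y} p = ∼-trans H (≈⇒∼ H (sym (\\-leftDividesʳ x g)))
    (∼-trans H (∙-∼ H (x ⁻¹) p) (≈⇒∼ H (sym (assoc _ _ _))))

  -- Finiteness of [A : A ∩ B]. Neither B nor the listed elements need lie in A, so the same list
  -- serves every smaller A.
  FiniteIndex : Subgroup G → Subgroup G → Set ℓ
  FiniteIndex A B = ∃[ xs ] (∀ {a} → a ∈ Mem A → Any (_∼[ B ] a) xs)

  -- For a subgroup A, n is [A : A ∩ B]. A is a mere predicate because `transversal` builds up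
  -- through the subsets `Meets xs`, which need not be subgroups.
  record Transversal (A : Pred Carrier ℓ) (B : Subgroup G) (n : ℕ) : Set ℓ where
    field
      rep      : Fin n → Carrier
      rep∈     : ∀ i → rep i ∈ A
      cover    : ∀ {a} → a ∈ A → ∃[ i ] rep i ∼[ B ] a
      distinct : ∀ {i j} → rep i ∼[ B ] rep j → i ≡ j

  -- Prunes the covering list: an entry is dropped if its coset misses A or is already represented,
  -- and otherwise yields a representative inside A. This takes at most two undecidable case
  -- distinctions per entry.
  transversal : ∀ A B → FiniteIndex A B → ¬ ¬ (∃[ n ] Transversal (Mem A) B n)
  transversal A B (xs , covers) = do
    n , t ← go xs
    let open Transversal t
    pure (n , record
      { rep      = rep
      ; rep∈     = proj₁ ∘ rep∈
      ; cover    = λ a∈A → cover (a∈A , covers a∈A)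
      ; distinct = distinct
      })
    where
    Meets : List Carrier → Pred Carrier ℓ
    Meets xs a = a ∈ Mem A × Any (_∼[ B ] a) xs

    go : ∀ xs → ¬ ¬ (∃[ n ] Transversal (Meets xs) B n)
    go []       = pure (0 , record
      { rep = λ () ; rep∈ = λ () ; cover = λ () ; distinct = λ { {()} } })
    go (x ∷ xs) = go xs >>= λ (n , t) →
      let open Transversal t in
      ¬¬-excluded-middle {A = ∃[ a ] a ∈ Mem A × x ∼[ B ] a} >>= λ where
        (no none) → pure (n , record
          { rep      = rep
          ; rep∈     = λ i → proj₁ (rep∈ i) , there (proj₂ (rep∈ i))
          ; cover    = λ { (a∈A , here x∼a) → contradiction (_ , a∈A , x∼a) none
                         ; (a∈A , there p)  → cover (a∈A , p) }
          ; distinct = distinct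
          })
        (yes (a , a∈A , x∼a)) →
          ¬¬-excluded-middle {A = ∃[ i ] rep i ∼[ B ] a} >>= λ where
            (yes (i , ri∼a)) → pure (n , record
              { rep      = rep
              ; rep∈     = λ i → proj₁ (rep∈ i) , there (proj₂ (rep∈ i))
              ; cover    = λ { (_ , here x∼a′) →
                                 i , ∼-trans B ri∼a (∼-trans B (∼-sym B x∼a) x∼a′)
                             ; (a∈A , there p) → cover (a∈A , p) }
              ; distinct = distinct
              })
            (no new) → pure (suc n , record
              { rep      = λ { zero → a ; (suc i) → rep i }
              ; rep∈     = λ { zero    → a∈A , here x∼a
                             ; (suc i) → proj₁ (rep∈ i) , there (proj₂ (rep∈ i)) }
              ; cover    = λ { (_ , here x∼a′)  → zero , ∼-trans B (∼-sym B x∼a) x∼a′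
                             ; (a′∈A , there p) → let i , q = cover (a′∈A , p) in suc i , q }
              ; distinct = λ { {zero}  {zero}  _ → ≡.refl
                             ; {zero}  {suc j} p → contradiction (j , ∼-sym B p) new
                             ; {suc i} {zero}  p → contradiction (i , p) new
                             ; {suc i} {suc j} p → ≡.cong suc (distinct p) }
              })

  FiniteIndex-⊆ : ∀ (A A′ B : Subgroup G) → Mem A ⊆ Mem A′ → FiniteIndex A′ B → FiniteIndex A B
  FiniteIndex-⊆ A A′ B A⊆A′ (xs , covers) = xs , covers ∘ A⊆A′

  -- Finite index reduces the inclusion to membership of finitely many representatives, so if no
  -- witness existed, all of them could be assumed to lie in B.
  ⊈⇒¬¬∃ : ∀ (A B : Subgroup G) → FiniteIndex A B → ¬ (Mem A ⊆ Mem B) →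
          ¬ ¬ (∃[ x ] x ∈ Mem A × ¬ (x ∈ Mem B))
  ⊈⇒¬¬∃ A B fi A⊈B k = transversal A B fi λ (n , t) →
    let open Transversal t in
    ¬¬-sequence {P = λ i → rep i ∈ Mem B} (λ i ri∉B → k (rep i , rep∈ i , ri∉B)) λ reps∈B →
    A⊈B λ a∈A → let i , ri∼a = cover a∈A in ∈-resp-∼ B ri∼a (reps∈B i)

  transversal-1 : ∀ (A B : Subgroup G) → Transversal (Mem A) B 1 → Mem A ⊆ Mem B
  transversal-1 A B t a∈A with cover (Subgroup.ε-closed A) | cover a∈A
    where open Transversal t
  ... | zero , r∼ε | zero , r∼a = ε∼⇒∈ B (∼-trans B (∼-sym B r∼ε) r∼a)

  -- The tower law for indices. The representatives are products ordered by `remQuot`; `sum≈0` uses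
  -- this explicit form to turn an orbit sum into a double sum.
  transversal-* : ∀ (A B C : Subgroup G) {m n} → Mem B ⊆ Mem A → Mem C ⊆ Mem B →
                  Transversal (Mem A) B m → Transversal (Mem B) C n → Transversal (Mem A) C (m * n)
  transversal-* A B C {m} {n} B⊆A C⊆B s t = record
    { rep      = λ k → rep₂ (remQuot n k)
    ; rep∈     = λ k → let i , j = remQuot {m} n k in
                   Subgroup.∙-closed A (S.rep∈ i) (B⊆A (T.rep∈ j))
    ; cover    = λ {a} a∈A →
        let i , p = S.cover a∈A
            j , q = T.cover p
        in combine i j , ≡.subst (λ z → rep₂ z ∼[ C ] a) (≡.sym (remQuot-combine i j))
             (∼-trans C (∙-∼ C (S.rep i) q) (≈⇒∼ C (\\-leftDividesˡ (S.rep i) a)))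
    ; distinct = λ {k} {l} p → ≡.trans (≡.sym (combine-remQuot {m} n k))
        (≡.trans (≡.cong (λ (i , j) → combine i j) (distinct₂ p)) (combine-remQuot {m} n l))
    }
    where
    module S = Transversal s
    module T = Transversal t
    rep₂ : Fin m × Fin n → Carrier
    rep₂ (i , j) = S.rep i ∙ T.rep j
    distinct₂ : ∀ {x y} → rep₂ x ∼[ C ] rep₂ y → x ≡ y
    -- Each product lies in the B-coset of its first factor, so these factors agree and can be
    -- cancelled.
    distinct₂ {i , j} {i′ , j′} p
      with S.distinct (∼-trans B (∼∙ B _ (T.rep∈ j))
             (∼-trans B (C⊆B p) (∼-sym B (∼∙ B _ (T.rep∈ j′)))))
    ... | ≡.refl = ≡.cong (i ,_) (T.distinct (∙-∼-cancel C (S.rep i) p))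

  transversal-⊓ : ∀ A B {n} → Transversal (Mem A) (A ⊓ B) n → Transversal (Mem A) B n
  transversal-⊓ A B t = record
    { rep      = rep
    ; rep∈     = rep∈
    ; cover    = λ a∈A → let i , p = cover a∈A in i , proj₂ p
    ; distinct = λ {i} {j} p → distinct (∈⇒∼ A (rep∈ i) (rep∈ j) , p)
    }
    where open Transversal t

  restrict : (U N : Subgroup G) → Subgroup (subgroup⇒group U)
  restrict U N = record
    { Mem       = Mem N ∘ proj₁
    ; resp-≈    = N.resp-≈
    ; ε-closed  = N.ε-closed
    ; ∙-closed  = N.∙-closed
    ; ⁻¹-closed = N.⁻¹-closed
    }
    where module N = Subgroup N

  -- Links the index of the pro-p condition with transversals: a representative goes to the number
  -- of its class, a number to the representative of a preimage, and both maps are injective.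
  HasIndex-unique : ∀ (U N : Subgroup G) {m n} →
                    HasIndex (restrict U N) m → Transversal (Mem U) N n → n ≡ m
  HasIndex-unique U N {m} {n} ix t =
    cantor-schröder-bernstein {f = f} {g = g}
      (λ p → distinct (Bijection.injective ix p))
      (λ {i} {j} p → ≡.trans (≡.sym (to-pre i))
        (≡.trans (Bijection.cong ix (∼-trans N (∼-sym N (proj₂ (cover-pre i)))
          (≡.subst (λ k → rep k ∼[ N ] proj₁ (pre j)) (≡.sym p) (proj₂ (cover-pre j)))))
        (to-pre j)))
    where
    open Transversal t
    f : Fin n → Fin m
    f i = Bijection.to ix (rep i , rep∈ i)
    pre : Fin m → Σ Carrier (Mem U)
    pre i = proj₁ (Bijection.surjective ix i)
    to-pre : ∀ i → Bijection.to ix (pre i) ≡ i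
    to-pre i = proj₂ (Bijection.surjective ix i) (∼-refl N)
    cover-pre : ∀ i → ∃[ k ] rep k ∼[ N ] proj₁ (pre i)
    cover-pre i = cover (proj₂ (pre i))
    g : Fin m → Fin n
    g i = proj₁ (cover-pre i)

  -- The normal core of B in U, that is, the kernel of the action of U on the cosets v B with v in
  -- U.
  core : Subgroup G → Subgroup G → Subgroup G
  core U B = record
    { Mem       = λ x → x ∈ Mem U × (∀ {v} → v ∈ Mem U → x ∈ Mem (stab B v))
    ; resp-≈    = λ e (u , s) → U.resp-≈ e u , λ {v} v∈U → Subgroup.resp-≈ (stab B v) e (s v∈U)
    ; ε-closed  = U.ε-closed , λ {v} _ → Subgroup.ε-closed (stab B v)
    ; ∙-closed  = λ (u , s) (u′ , s′) → U.∙-closed u u′ ,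
        λ {v} v∈U → Subgroup.∙-closed (stab B v) (s v∈U) (s′ v∈U)
    ; ⁻¹-closed = λ (u , s) → U.⁻¹-closed u ,
        λ {v} v∈U → Subgroup.⁻¹-closed (stab B v) (s v∈U)
    }
    where module U = Subgroup U

  core⊆ : ∀ U B → Mem (core U B) ⊆ Mem B
  core⊆ U B (_ , s) = ε∼⇒∈ B (∼-trans B (s (Subgroup.ε-closed U)) (≈⇒∼ B (identityʳ _)))

  -- For g in U, also g⁻¹ v is in U, so n fixes g⁻¹ v B; translating by g shows that g n g⁻¹ fixes v
  -- B.
  core-normal : ∀ U B → IsNormal (restrict U (core U B))
  core-normal U B (g , g∈U) {n , _} (n∈U , s) =
    U.∙-closed (U.∙-closed g∈U n∈U) (U.⁻¹-closed g∈U) ,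
    λ {v} v∈U → ∼-trans B (≈⇒∼ B (sym (\\-leftDividesˡ g v)))
      (∼-trans B (∙-∼ B g (s (U.∙-closed (U.⁻¹-closed g∈U) v∈U)))
        (≈⇒∼ B (trans (∙-congˡ (sym (assoc _ _ _)))
          (trans (sym (assoc _ _ _)) (∙-congʳ (sym (assoc _ _ _)))))))
    where module U = Subgroup U

-- Prime powers, the characteristic of a field, stabilisers

∣prime^⇒≡1⊎prime∣ : ∀ {p} → Prime p → ∀ n {y} → y ∣ p ^ n → y ≡ 1 ⊎ p ∣ y
∣prime^⇒≡1⊎prime∣ pr zero y∣1 = inj₁ (∣1⇒≡1 y∣1)
∣prime^⇒≡1⊎prime∣ {p} pr (suc n) {y} y∣ with p ∣? y
... | yes p∣y = inj₂ p∣y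
... | no  p∤y = ∣prime^⇒≡1⊎prime∣ pr n (coprime-divisor coprime y∣)
  where
  coprime : Coprime y p
  coprime {d} (d∣y , d∣p) with prime⇒irreducible pr d∣p
  ... | inj₁ d≡1    = d≡1
  ... | inj₂ ≡.refl = contradiction d∣y p∤y

-- If p = q d with 1 < d < p, then d · 1 is nonzero, hence invertible; cancelling it from p · 1 = 0
-- leaves q · 1 = 0 with 0 < q < p.
char-prime : ∀ {ℓ} (F : CommutativeRing ℓ ℓ) {p} → 0 < p →
             IsField F → HasCharacteristic F p → Prime p
char-prime F {zero} () _ _
char-prime F {1} _ isField char =
  contradiction (trans (sym (+-identityʳ 1#)) (Equivalence.from (char 1) ∣-refl))
                (IsField.1≉0 isField)
  where open CommutativeRing F
char-prime F {p@(suc (suc _))} _ isField char = prime not-composite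
  where
  open CommutativeRing F renaming (_*_ to _⋆_)
  open import Algebra.Properties.Semiring.Mult semiring using (×1-homo-*) renaming (_×_ to _·_)
  open import Relation.Binary.Reasoning.Setoid setoid
  not-composite : ¬ Composite p
  not-composite (composite {d} d<p (divides zero ()))
  not-composite (composite {d} d<p (divides q@(suc _) p≡qd)) =
    >⇒∤ q<p (Equivalence.to (char q) q·1≈0)
    where
    instance
      _ = nonTrivial⇒nonZero d
    d∤ : ¬ (p ∣ d)
    d∤ = >⇒∤ d<p
    q<p : q < p
    q<p = ≡.subst (q <_) (≡.sym p≡qd) (m<m*n q d (nonTrivial⇒n>1 d))
    inv = IsField.≉0⇒invertible isField (d · 1#) (d∤ ∘ Equivalence.to (char d))
    q·1≈0 : q · 1# ≈ 0#
    q·1≈0 = begin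
      q · 1#                                ≈⟨ *-identityʳ _ ⟨
      q · 1# ⋆ 1#                           ≈⟨ *-congˡ (proj₂ (proj₂ inv)) ⟨
      q · 1# ⋆ (d · 1# ⋆ proj₁ inv)         ≈⟨ *-assoc _ _ _ ⟨
      q · 1# ⋆ (d · 1#) ⋆ proj₁ inv         ≈⟨ *-congʳ (×1-homo-* q d) ⟨
      (q * d) · 1# ⋆ proj₁ inv              ≡⟨ ≡.cong (λ n → n · 1# ⋆ proj₁ inv) p≡qd ⟨
      p · 1# ⋆ proj₁ inv                    ≈⟨ *-congʳ (Equivalence.from (char p) ∣-refl) ⟩
      0# ⋆ proj₁ inv                        ≈⟨ zeroˡ _ ⟩
      0#                                    ∎

module _ {ℓ} {G : Group ℓ ℓ} (X : Setoid ℓ ℓ) where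
  open Group G
  private module X = Setoid X

  pointStabiliser : (_·_ : Carrier → X.Carrier → X.Carrier) →
                    (∀ g {x y} → x X.≈ y → (g · x) X.≈ (g · y)) →
                    (∀ {g h} x → g ≈ h → (g · x) X.≈ (h · x)) →
                    (∀ x → (ε · x) X.≈ x) →
                    (∀ g h x → ((g ∙ h) · x) X.≈ (g · (h · x))) →
                    X.Carrier → Subgroup G
  pointStabiliser _·_ ·-cong ·-congʳ ε-· ∙-· x = record
    { Mem       = λ g → (g · x) X.≈ x
    ; resp-≈    = λ g≈h p → X.trans (X.sym (·-congʳ x g≈h)) p
    ; ε-closed  = ε-· x
    ; ∙-closed  = λ {g} {h} p q → X.trans (∙-· g h x) (X.trans (·-cong g q) p)
    ; ⁻¹-closed = λ {g} p → X.trans (X.sym (·-cong (g ⁻¹) p))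
        (X.trans (X.sym (∙-· (g ⁻¹) g x)) (X.trans (·-congʳ x (inverseˡ g)) (ε-· x)))
    }

-- Open subgroups, pro-p indices and fairness

module Topology {ℓ o} (G : TopologicalGroup ℓ o) where
  open TopologicalGroup G
  open GroupProperties group
  open Cosets group

  -- Continuity is given pointwise, so the preimage is assembled as the union of the neighbourhoods
  -- obtained at its own points.
  open-∙ˡ : ∀ {U} → Open U → ∀ g → Open (λ x → g ∙ x ∈ U)
  open-∙ˡ {U} oU g = open-resp-≐ (fwd , bwd) (open-⋃ nbhd nbhd-open)
    where
    I = Σ[ x ∈ Carrier ] g ∙ x ∈ U
    nbhd : I → Pred Carrier ℓ
    nbhd (x , m) = proj₁ (proj₂ (∙-continuous oU g x m))
    nbhd-open : ∀ i → Open (nbhd i)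
    nbhd-open (x , m) = let _ , _ , _ , oB , _ = ∙-continuous oU g x m in oB
    fwd : ∀ {z} → ∃[ i ] z ∈ nbhd i → g ∙ z ∈ U
    fwd ((x , m) , z∈B) = let _ , _ , _ , _ , g∈A , _ , AB⊆U = ∙-continuous oU g x m in AB⊆U g∈A z∈B
    bwd : ∀ {z} → g ∙ z ∈ U → ∃[ i ] z ∈ nbhd i
    bwd {z} m = let _ , _ , _ , _ , _ , z∈B , _ = ∙-continuous oU g z m in (z , m) , z∈B

  -- Inversion turns right translation into left translation: x g = (g⁻¹ x⁻¹)⁻¹.
  open-∙ʳ : ∀ {U} → Open U → ∀ g → Open (λ x → x ∙ g ∈ U)
  open-∙ʳ {U} oU g = open-resp-≐ (open⇒resp-≈ oU flip , open⇒resp-≈ oU (sym flip))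
    (⁻¹-continuous (open-∙ˡ (⁻¹-continuous oU) (g ⁻¹)))
    where
    flip : ∀ {x} → (g ⁻¹ ∙ x ⁻¹) ⁻¹ ≈ x ∙ g
    flip = trans (⁻¹-anti-homo-∙ _ _) (∙-cong (⁻¹-involutive _) (⁻¹-involutive g))

  open-stab : ∀ H → Open (Mem H) → ∀ g → Open (Mem (stab H g))
  open-stab H oH g = open-∙ʳ (open-∙ˡ oH (g ⁻¹)) g

  -- H is the union of the open cosets q W with q in H.
  open-⊇ : ∀ (H W : Subgroup group) → Open (Mem W) → Mem W ⊆ Mem H → Open (Mem H)
  open-⊇ H W oW W⊆H = open-resp-≐
    ( (λ { ((q , q∈H) , q∼x) → ∈-resp-∼ H (W⊆H q∼x) q∈H })
    , (λ {x} x∈H → (x , x∈H) , ∼-refl W))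
    (open-⋃ {I = Σ Carrier (Mem H)} (λ (q , _) x → q ∼[ W ] x) (λ (q , _) → open-∙ˡ oW (q ⁻¹)))

  compact⇒FiniteIndex : ∀ (U B : Subgroup group) → IsCompact (induced G U) → Open (Mem B) →
                        FiniteIndex U B
  compact⇒FiniteIndex U B compact oB =
    let is , covers = compact {I = Σ Carrier (Mem U)} (λ (k , _) (u , _) → k ∼[ B ] u)
                        (λ (k , _) → _ , open-∙ˡ oB (k ⁻¹) , id , id)
                        (λ i → i , ∼-refl B)
    in map proj₁ is , λ {a} a∈U → Any.map⁺ (covers (a , a∈U))

  -- An element of U that fixes the finitely many listed cosets fixes v B for every v in U, so the
  -- core contains a finite intersection of open stabilisers.
  open-core : ∀ (U B : Subgroup group) → Open (Mem U) → Open (Mem B) → FiniteIndex U B →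
              Open (Mem (core U B))
  open-core U B oU oB (xs , covers) = open-⊇ (core U B) (U ⊓ ⋂stab xs) (open-∩ oU (open-⋂stab xs))
    λ { {x} (x∈U , x∈⋂) → x∈U , λ {v} v∈U →
        let y , y∼v , x∈stab = pick x∈⋂ (covers v∈U)
        in ∼-trans B (∼-sym B y∼v) (∼-trans B x∈stab (∙-∼ B x y∼v)) }
    where
    ⋂stab : List Carrier → Subgroup group
    -- The empty intersection is U, an open subgroup that contains the core anyway.
    ⋂stab []       = U
    ⋂stab (x ∷ xs) = stab B x ⊓ ⋂stab xs
    open-⋂stab : ∀ xs → Open (Mem (⋂stab xs))
    open-⋂stab []       = oU
    open-⋂stab (x ∷ xs) = open-∩ (open-stab B oB x) (open-⋂stab xs)
    pick : ∀ {xs x v} → x ∈ Mem (⋂stab xs) → Any (_∼[ B ] v) xs →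
           ∃[ y ] y ∼[ B ] v × x ∈ Mem (stab B y)
    pick (s , _) (here p)  = _ , p , s
    pick (_ , s) (there p) = pick s p

  -- With N the core of T in U, [U : S][S : T][T : N] = [U : N] is a power of p. Hence [S : T] is 1
  -- or divisible by p, and 1 would give S ⊆ T.
  proP-index : ∀ {p} → Prime p → ∀ (U S T : Subgroup group) →
               Open (Mem U) → IsProP (induced G U) p →
               Open (Mem T) → Mem T ⊆ Mem S → Mem S ⊆ Mem U → ¬ (Mem S ⊆ Mem T) →
               ¬ ¬ (∃[ n ] Transversal (Mem S) T n × p ∣ n)
  proP-index {p} pr U S T oU proP oT T⊆S S⊆U S⊈T = do
    l , U/S ← transversal U S (finite S (open-⊇ S T oT T⊆S))
    n , S/T ← transversal S T (FiniteIndex-⊆ S U T S⊆U (finite T oT))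
    m , T/N ← transversal T N (FiniteIndex-⊆ T U N (S⊆U ∘ T⊆S) (finite N oN))
    let k , index = IsProP.p-power-index proP (restrict U N) (_ , oN , id , id) (core-normal U T)
        size≡ = HasIndex-unique U N index
          (transversal-* U S N S⊆U (T⊆S ∘ core⊆ U T) U/S
            (transversal-* S T N T⊆S (core⊆ U T) S/T T/N))
    case ∣prime^⇒≡1⊎prime∣ pr k (≡.subst (n ∣_) size≡ (∣-trans (m∣m*n m) (n∣m*n l))) of λ where
      (inj₁ ≡.refl) → contradiction (λ {x} → transversal-1 S T S/T {x}) S⊈T
      (inj₂ p∣n)    → pure (n , S/T , p∣n)
    where
    N = core U T
    finite : ∀ (B : Subgroup group) → Open (Mem B) → FiniteIndex U B
    finite B = compact⇒FiniteIndex U B (IsProfinite.compact (IsProP.isProfinite proP))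
    oN = open-core U T oU oT (finite T oT)

  module Fairness (K : Subgroup group) (compact : IsCompact (induced G K)) (fair : IsFair G K) where

    record OpenSubgroup : Set (Level.suc ℓ ⊔ o) where
      field
        subgroup : Subgroup group
        isOpen   : Open (Mem subgroup)
        ⊆K       : Mem subgroup ⊆ Mem K
    open OpenSubgroup

    -- For H′ ⊆ H this is J ∩ g H′ g⁻¹ ≠ J ∩ g H g⁻¹ for all g. It is negative because fairness
    -- provides no element in the difference.
    Shrinks : Subgroup group → Subgroup group → Subgroup group → Set ℓ
    Shrinks J H H′ = ∀ g → ¬ (Mem (J ⊓ stab H g) ⊆ Mem (stab H′ g))

    shrink : OpenSubgroup → OpenSubgroup
    shrink H = let H′ , oH′ , (H′⊆H , _) , _ = fair (subgroup H) (isOpen H) (⊆K H) in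
      record { subgroup = H′ ; isOpen = oH′ ; ⊆K = ⊆K H ∘ H′⊆H }

    shrink-⊆ : ∀ H → Mem (subgroup (shrink H)) ⊆ Mem (subgroup H)
    shrink-⊆ H = let _ , _ , (H′⊆H , _) , _ = fair (subgroup H) (isOpen H) (⊆K H) in H′⊆H

    shrink-shrinks : ∀ H → Shrinks K (subgroup H) (subgroup (shrink H))
    shrink-shrinks H g ⊆ = let H′ , _ , _ , strict = fair (subgroup H) (isOpen H) (⊆K H) in
      proj₂ (strict g) λ (x∈K , x∈gHg⁻¹) →
        x∈K , stab⇒Conj H′ g (⊆ (x∈K , Conj⇒stab (subgroup H) g x∈gHg⁻¹))

    chain : OpenSubgroup → ℕ → OpenSubgroup
    chain H zero    = H
    chain H (suc n) = shrink (chain H n)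

    chain-⊆ : ∀ H {m n} → m ≤′ n → Mem (subgroup (chain H n)) ⊆ Mem (subgroup (chain H m))
    chain-⊆ H ≤′-refl     = id
    chain-⊆ H {m} (≤′-step {n} p) = chain-⊆ H {m} {n} p ∘ shrink-⊆ (chain H n)

    -- Write S_i = K ∩ g H_i g⁻¹ for the chain H_i.  Elements of S_i ∖ S_{i+1}, one for each
    -- i = 0, …, [K : J], cannot lie in distinct cosets of J; if those for i < j share a coset,
    -- their quotient lies in J ∩ S_i but not in S_{i+1}.
    fair-⊓ : ∀ (J : Subgroup group) → Open (Mem J) → ∀ (H : OpenSubgroup) →
             Σ[ H′ ∈ OpenSubgroup ] Mem (subgroup H′) ⊆ Mem (subgroup H) ×
               Shrinks J (subgroup H) (subgroup H′)
    -- m is the length of a list of cosets covering K, so m + 1 gaps force a collision; the last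
    -- gap, at i = m, ends at `C (suc m)`.
    fair-⊓ J oJ H = C (suc m) , chain-⊆ H {0} {suc m} (≤⇒≤′ z≤n) , λ g sub →
      ¬¬-sequence (gap g) λ gaps →
      let coset = λ i → Any.index (covers (∈K g (toℕ i) (gaps i)))
          i , j , i<j , same = pigeonhole (n<1+n m) coset in
      collision g sub i j (gaps i) (gaps j) i<j same
      where
      K/J : FiniteIndex K J
      K/J = compact⇒FiniteIndex K J compact oJ
      m = length (proj₁ K/J)
      covers : ∀ {a} → a ∈ Mem K → Any (_∼[ J ] a) (proj₁ K/J)
      covers = proj₂ K/J
      C = chain H
      S : Carrier → ℕ → Subgroup group
      S g n = stab (subgroup (C n)) g

      S-⊆ : ∀ g {n k} → n ≤ k → Mem (S g k) ⊆ Mem (S g n)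
      S-⊆ g {n} {k} n≤k = chain-⊆ H {n} {k} (≤⇒≤′ n≤k)

      Gap : Carrier → ℕ → Set ℓ
      Gap g n = ∃[ x ] x ∈ Mem (K ⊓ S g n) × ¬ (x ∈ Mem (S g (suc n)))

      ∈K : ∀ g n (gap : Gap g n) → proj₁ gap ∈ Mem K
      ∈K _ _ (_ , (x∈K , _) , _) = x∈K

      gap : ∀ g (i : Fin (suc m)) → ¬ ¬ Gap g (toℕ i)
      gap g i = ⊈⇒¬¬∃ (K ⊓ S g n) (S g (suc n))
        (FiniteIndex-⊆ (K ⊓ S g n) K (S g (suc n)) proj₁
          (compact⇒FiniteIndex K (S g (suc n)) compact
            (open-stab (subgroup (C (suc n))) (isOpen (C (suc n))) g)))
        (shrink-shrinks (C n) g)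
        where n = toℕ i

      collision : ∀ g → Mem (J ⊓ S g 0) ⊆ Mem (S g (suc m)) →
                  ∀ (i j : Fin (suc m)) (x : Gap g (toℕ i)) (y : Gap g (toℕ j)) → i Fin.< j →
                  Any.index (covers (∈K g (toℕ i) x)) ≡ Any.index (covers (∈K g (toℕ j) y)) → ⊥
      collision g sub i j (x , (x∈K , x∈Sᵢ) , x∉) (y , (y∈K , y∈Sⱼ) , _) i<j same =
        -- By `sub` the quotient of x and y lies in S_{m+1} ⊆ S_{i+1}. Since i < j, also y lies in
        -- S_{i+1}, and then so does x.
        x∉ (∈-resp-∼ S⁺ (∼-sym S⁺ x∼y) (S-⊆ g i<j y∈Sⱼ))
        where
        S⁺ = S g (suc (toℕ i))
        x∼y-mod-J : x ∼[ J ] y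
        x∼y-mod-J = ∼-trans J (∼-sym J (Any.lookup-index (covers x∈K)))
          (≡.subst (λ k → lookup (proj₁ K/J) k ∼[ J ] y) (≡.sym same)
            (Any.lookup-index (covers y∈K)))
        x∼y : x ∼[ S⁺ ] y
        x∼y = S-⊆ g (toℕ<n i) (sub (x∼y-mod-J ,
          ∈⇒∼ (S g 0) (S-⊆ g {0} {toℕ i} z≤n x∈Sᵢ) (S-⊆ g {0} {toℕ j} z≤n y∈Sⱼ)))

-- Free modules and coefficients

module Sums {c ℓ} (M : CommutativeMonoid c ℓ) where
  open CommutativeMonoid M
  open Sum M

  sum-≈ε : ∀ {n} {f : Fin n → Carrier} → (∀ i → f i ≈ ε) → sum f ≈ ε
  sum-≈ε {n} f≈ε = trans (sum-cong-≋ f≈ε) (sum-replicate-zero n)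

  sum-single : ∀ {n} {f : Fin n → Carrier} j → (∀ i → i ≢ j → f i ≈ ε) → sum f ≈ f j
  sum-single zero    f≈ε = trans (∙-congˡ (sum-≈ε λ i → f≈ε (suc i) λ ())) (identityʳ _)
  sum-single (suc j) f≈ε = trans (∙-cong (f≈ε zero λ ())
    (sum-single j λ i i≢j → f≈ε (suc i) λ { ≡.refl → i≢j ≡.refl })) (identityˡ _)

  sum-homo : (f : Carrier → Carrier) → f ε ≈ ε → (∀ x y → f (x ∙ y) ≈ f x ∙ f y) →
             ∀ {n} (t : Fin n → Carrier) → f (sum t) ≈ sum (f ∘ t)
  sum-homo f f-ε f-∙ {zero}  t = f-ε
  sum-homo f f-ε f-∙ {suc n} t = trans (f-∙ _ _) (∙-congˡ (sum-homo f f-ε f-∙ (t ∘ suc)))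

  sum-splitAt : ∀ m {n} (f : Fin m ⊎ Fin n → Carrier) →
                sum (f ∘ splitAt m) ≈ sum (f ∘ inj₁) ∙ sum (f ∘ inj₂)
  sum-splitAt zero    f = sym (identityˡ _)
  sum-splitAt (suc m) f =
    trans (∙-congˡ (sum-splitAt m (f ∘ Sum⊎.map₁ suc))) (sym (assoc _ _ _))

  sum-remQuot : ∀ m n (f : Fin m × Fin n → Carrier) →
                sum (f ∘ remQuot {m} n) ≈ sum λ i → sum λ j → f (i , j)
  sum-remQuot zero    n f = refl
  sum-remQuot (suc m) n f = trans
    -- This function is one unfolding of `remQuot` after its initial `splitAt n`.
    (sum-splitAt n (f ∘ swap ∘ [ _, zero , map₂ suc ∘ quotRem {m} n ]′))
    (∙-congˡ (sum-remQuot m n (f ∘ map₁ suc)))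

module FreeModule {ℓ} (F : CommutativeRing ℓ ℓ) (B : Setoid ℓ ℓ) where
  private
    module F = CommutativeRing F
    module B = Setoid B
  open F using (0#; 1#) renaming (Carrier to S; _≈_ to _≈ˢ_; _+_ to _+ˢ_; _*_ to _*ˢ_)
  open B using () renaming (Carrier to Basis; _≈_ to _≃_)

  infixr 6 _⊕_
  infixr 7 _⊙_
  infix  4 _≈ᵗ_

  -- Terms modulo the module axioms. With finitely supported functions, already the indicator
  -- function of a basis element would require decidable equality of the basis.
  data Term : Set ℓ where
    0ᵗ  : Term
    _⊕_ : Term → Term → Term
    _⊙_ : S → Term → Term
    [_] : Basis → Term

  data _≈ᵗ_ : Term → Term → Set ℓ where
    reflᵗ       : ∀ {x} → x ≈ᵗ x
    symᵗ        : ∀ {x y} → x ≈ᵗ y → y ≈ᵗ x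
    transᵗ      : ∀ {x y z} → x ≈ᵗ y → y ≈ᵗ z → x ≈ᵗ z
    ⊕-cong      : ∀ {x x′ y y′} → x ≈ᵗ x′ → y ≈ᵗ y′ → x ⊕ y ≈ᵗ x′ ⊕ y′
    ⊕-assoc     : ∀ x y z → (x ⊕ y) ⊕ z ≈ᵗ x ⊕ (y ⊕ z)
    ⊕-identityˡ : ∀ x → 0ᵗ ⊕ x ≈ᵗ x
    ⊕-comm      : ∀ x y → x ⊕ y ≈ᵗ y ⊕ x
    ⊙-cong      : ∀ {a a′ x x′} → a ≈ˢ a′ → x ≈ᵗ x′ → a ⊙ x ≈ᵗ a′ ⊙ x′
    ⊙-zeroˡ     : ∀ x → 0# ⊙ x ≈ᵗ 0ᵗ
    ⊙-distribʳ  : ∀ x a b → (a +ˢ b) ⊙ x ≈ᵗ a ⊙ x ⊕ b ⊙ x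
    ⊙-distribˡ  : ∀ a x y → a ⊙ (x ⊕ y) ≈ᵗ a ⊙ x ⊕ a ⊙ y
    ⊙-identityˡ : ∀ x → 1# ⊙ x ≈ᵗ x
    ⊙-assoc     : ∀ a b x → (a *ˢ b) ⊙ x ≈ᵗ a ⊙ b ⊙ x
    []-cong     : ∀ {b b′} → b ≃ b′ → [ b ] ≈ᵗ [ b′ ]

  freeModule : Module F ℓ ℓ
  freeModule = record
    { Carrierᴹ = Term
    ; _≈ᴹ_     = _≈ᵗ_
    ; _+ᴹ_     = _⊕_
    ; _*ₗ_     = _⊙_
    ; _*ᵣ_     = λ x a → a ⊙ x
    ; 0ᴹ       = 0ᵗ
    ; -ᴹ_      = F.- 1# ⊙_
    ; isModule = IsModuleFromLeft.isModule {commutativeRing = F} record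
      { isLeftModule = record
        { isLeftSemimodule = record
          { +ᴹ-isCommutativeMonoid = record
            { isMonoid = record
              { isSemigroup = record
                { isMagma = record
                  { isEquivalence = record { refl = reflᵗ ; sym = symᵗ ; trans = transᵗ }
                  ; ∙-cong        = ⊕-cong
                  }
                ; assoc = ⊕-assoc
                }
              ; identity = ⊕-identityˡ , λ x → transᵗ (⊕-comm x 0ᵗ) (⊕-identityˡ x)
              }
            ; comm = ⊕-comm
            }
          ; isPreleftSemimodule = record
            { *ₗ-cong      = ⊙-cong
            ; *ₗ-zeroˡ     = ⊙-zeroˡ
            ; *ₗ-distribʳ  = ⊙-distribʳ
            ; *ₗ-identityˡ = ⊙-identityˡ
            ; *ₗ-assoc     = ⊙-assoc
            ; *ₗ-zeroʳ     = λ a → transᵗ (⊙-cong F.refl (symᵗ (⊙-zeroˡ 0ᵗ)))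
                (transᵗ (symᵗ (⊙-assoc a 0# 0ᵗ)) (transᵗ (⊙-cong (F.zeroʳ a) reflᵗ) (⊙-zeroˡ 0ᵗ)))
            ; *ₗ-distribˡ  = ⊙-distribˡ
            }
          }
        ; -ᴹ‿cong    = ⊙-cong F.refl
        ; -ᴹ‿inverse = inverseˡ , λ x → transᵗ (⊕-comm x _) (inverseˡ x)
        }
      }
    }
    where
    inverseˡ : ∀ x → F.- 1# ⊙ x ⊕ x ≈ᵗ 0ᵗ
    inverseˡ x = transᵗ (⊕-cong reflᵗ (symᵗ (⊙-identityˡ x)))
      (transᵗ (symᵗ (⊙-distribʳ x _ _)) (transᵗ (⊙-cong (F.-‿inverseˡ 1#) reflᵗ) (⊙-zeroˡ x)))

  module Eval (N : Module F ℓ ℓ) (φ : Basis → Module.Carrierᴹ N)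
              (φ-cong : ∀ {b b′} → b ≃ b′ → Module._≈ᴹ_ N (φ b) (φ b′)) where
    open Module N

    eval : Term → Carrierᴹ
    eval 0ᵗ      = 0ᴹ
    eval (x ⊕ y) = eval x +ᴹ eval y
    eval (a ⊙ x) = a *ₗ eval x
    eval [ b ]   = φ b

    eval-cong : ∀ {x y} → x ≈ᵗ y → eval x ≈ᴹ eval y
    eval-cong reflᵗ               = ≈ᴹ-refl
    eval-cong (symᵗ p)            = ≈ᴹ-sym (eval-cong p)
    eval-cong (transᵗ p q)        = ≈ᴹ-trans (eval-cong p) (eval-cong q)
    eval-cong (⊕-cong p q)        = +ᴹ-cong (eval-cong p) (eval-cong q)
    eval-cong (⊕-assoc x y z)     = +ᴹ-assoc _ _ _
    eval-cong (⊕-identityˡ x)     = +ᴹ-identityˡ _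
    eval-cong (⊕-comm x y)        = +ᴹ-comm _ _
    eval-cong (⊙-cong p q)        = *ₗ-cong p (eval-cong q)
    eval-cong (⊙-zeroˡ x)         = *ₗ-zeroˡ _
    eval-cong (⊙-distribʳ x a b)  = *ₗ-distribʳ _ _ _
    eval-cong (⊙-distribˡ a x y)  = *ₗ-distribˡ _ _ _
    eval-cong (⊙-identityˡ x)     = *ₗ-identityˡ _
    eval-cong (⊙-assoc a b x)     = *ₗ-assoc _ _ _
    eval-cong ([]-cong p)         = φ-cong p

    eval-linear : ModuleMorphisms.IsModuleHomomorphism (Module.rawModule freeModule) rawModule eval
    eval-linear = record
      { isBimoduleHomomorphism = record
        { +ᴹ-isGroupHomomorphism = record
          { isMonoidHomomorphism = record
            { isMagmaHomomorphism = record
              { isRelHomomorphism = record { cong = eval-cong }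
              ; homo              = λ _ _ → ≈ᴹ-refl
              }
            ; ε-homo = ≈ᴹ-refl
            }
          ; ⁻¹-homo = λ x → -1*ₗ (eval x)
          }
        ; *ₗ-homo = λ _ _ → ≈ᴹ-refl
        ; *ᵣ-homo = λ a x → *ₗ-*ᵣ-coincident a (eval x)
        }
      }
      where
      -1*ₗ : ∀ v → F.- 1# *ₗ v ≈ᴹ -ᴹ v
      -1*ₗ v = GroupProperties.inverseˡ-unique +ᴹ-group _ v
        (≈ᴹ-trans (+ᴹ-congˡ (≈ᴹ-sym (*ₗ-identityˡ v))) (≈ᴹ-trans (≈ᴹ-sym (*ₗ-distribʳ v _ _))
          (≈ᴹ-trans (*ₗ-congʳ (F.-‿inverseˡ 1#)) (*ₗ-zeroˡ v))))

  -- Speaks of every basis element written in the term, even one whose coefficients cancel. It is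
  -- thus not invariant under `_≈ᵗ_`, but it is a finite conjunction and so commutes with double
  -- negation.
  Leafwise : ∀ {q} → (Basis → Set q) → Term → Set q
  Leafwise Q 0ᵗ      = ⊤
  Leafwise Q (x ⊕ y) = Leafwise Q x × Leafwise Q y
  Leafwise Q (a ⊙ x) = Leafwise Q x
  Leafwise Q [ b ]   = Q b

  leafwise : ∀ {q} {Q : Basis → Set q} → (∀ b → ¬ ¬ Q b) → ∀ x → ¬ ¬ Leafwise Q x
  leafwise Q? 0ᵗ      = pure tt
  leafwise Q? (x ⊕ y) = do
    p ← leafwise Q? x
    q ← leafwise Q? y
    pure (p , q)
  leafwise Q? (a ⊙ x) = leafwise Q? x
  leafwise Q? [ b ]   = Q? b

  leafwise-map : ∀ {q r} {Q : Basis → Set q} {R : Basis → Set r} →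
                 (∀ {b} → Q b → R b) → ∀ x → Leafwise Q x → Leafwise R x
  leafwise-map f 0ᵗ      _       = tt
  leafwise-map f (x ⊕ y) (p , q) = leafwise-map f x p , leafwise-map f y q
  leafwise-map f (a ⊙ x) p       = leafwise-map f x p
  leafwise-map f [ b ]   p       = f p

  leaves : Term → List Basis
  leaves 0ᵗ      = []
  leaves (x ⊕ y) = leaves x ++ leaves y
  leaves (a ⊙ x) = leaves x
  leaves [ b ]   = b ∷ []

  leaves-∈ : ∀ x → Leafwise (_∈ₗ leaves x) x
  leaves-∈ 0ᵗ      = tt
  leaves-∈ (x ⊕ y) =
    leafwise-map ∈-++⁺ˡ x (leaves-∈ x) , leafwise-map (∈-++⁺ʳ (leaves x)) y (leaves-∈ y)
  leaves-∈ (a ⊙ x) = leaves-∈ x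
  leaves-∈ [ b ]   = here ≡.refl

  module _ (N : Module F ℓ ℓ) (φ : Basis → Module.Carrierᴹ N)
           (φ-cong : ∀ {b b′} → b ≃ b′ → Module._≈ᴹ_ N (φ b) (φ b′)) where
    open Module N
    open Eval N φ φ-cong

    eval-no-leaves : ∀ x → Leafwise (_∈ₗ []) x → eval x ≈ᴹ 0ᴹ
    eval-no-leaves 0ᵗ      _       = ≈ᴹ-refl
    eval-no-leaves (x ⊕ y) (p , q) =
      ≈ᴹ-trans (+ᴹ-cong (eval-no-leaves x p) (eval-no-leaves y q)) (+ᴹ-identityˡ 0ᴹ)
    eval-no-leaves (a ⊙ x) p       = ≈ᴹ-trans (*ₗ-congˡ (eval-no-leaves x p)) (*ₗ-zeroʳ a)

  -- The coefficient of b is computable only relative to decisions of b ≃ b′ for the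
  -- finitely many b′ occurring in a term.
  Decided : Basis → Term → Set ℓ
  Decided b = Leafwise (λ b′ → Dec (b ≃ b′))

  decide : ∀ b x → ¬ ¬ Decided b x
  decide b = leafwise λ _ → ¬¬-excluded-middle

  δ : ∀ {q} {Q : Set q} → Dec Q → S
  δ (yes _) = 1#
  δ (no _)  = 0#

  δ-⇔ : ∀ {q r} {Q : Set q} {R : Set r} (d : Dec Q) (d′ : Dec R) → (Q → R) → (R → Q) → δ d ≈ˢ δ d′
  δ-⇔ (yes q) (yes r) f g = F.refl
  δ-⇔ (yes q) (no ¬r) f g = contradiction (f q) ¬r
  δ-⇔ (no ¬q) (yes r) f g = contradiction (g r) ¬q
  δ-⇔ (no ¬q) (no ¬r) f g = F.refl

  coef : ∀ b x → Decided b x → S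
  coef b 0ᵗ      _       = 0#
  coef b (x ⊕ y) (d , e) = coef b x d +ˢ coef b y e
  coef b (a ⊙ x) d       = a *ˢ coef b x d
  coef b [ b′ ]  d       = δ d

  coef-irrelevant : ∀ b x d e → coef b x d ≈ˢ coef b x e
  coef-irrelevant b 0ᵗ      _       _        = F.refl
  coef-irrelevant b (x ⊕ y) (d , d′) (e , e′) =
    F.+-cong (coef-irrelevant b x d e) (coef-irrelevant b y d′ e′)
  coef-irrelevant b (a ⊙ x) d       e        = F.*-congˡ (coef-irrelevant b x d e)
  coef-irrelevant b [ b′ ]  d       e        = δ-⇔ d e id id

  -- The decisions are part of the data, so that each axiom is checked with matching decisions on
  -- its two sides; `coef-irrelevant` later passes to arbitrary ones.
  EqualCoef : Basis → Term → Term → Set ℓ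
  EqualCoef b x y = Σ[ d ∈ Decided b x ] Σ[ e ∈ Decided b y ] coef b x d ≈ˢ coef b y e

  equalCoef : ∀ b {x y} → x ≈ᵗ y → ¬ ¬ EqualCoef b x y
  equalCoef b (reflᵗ {x}) = do
    d ← decide b x
    pure (d , d , F.refl)
  equalCoef b (symᵗ p) = do
    d , e , eq ← equalCoef b p
    pure (e , d , F.sym eq)
  equalCoef b (transᵗ {y = y} p q) = do
    d , e , eq ← equalCoef b p
    d′ , e′ , eq′ ← equalCoef b q
    pure (d , e′ , F.trans eq (F.trans (coef-irrelevant b y e d′) eq′))
  equalCoef b (⊕-cong p q) = do
    d , e , eq ← equalCoef b p
    d′ , e′ , eq′ ← equalCoef b q
    pure ((d , d′) , (e , e′) , F.+-cong eq eq′)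
  equalCoef b (⊕-assoc x y z) = do
    d ← decide b x
    e ← decide b y
    f ← decide b z
    pure (((d , e) , f) , (d , e , f) , F.+-assoc _ _ _)
  equalCoef b (⊕-identityˡ x) = do
    d ← decide b x
    pure ((tt , d) , d , F.+-identityˡ _)
  equalCoef b (⊕-comm x y) = do
    d ← decide b x
    e ← decide b y
    pure ((d , e) , (e , d) , F.+-comm _ _)
  equalCoef b (⊙-cong p q) = do
    d , e , eq ← equalCoef b q
    pure (d , e , F.*-cong p eq)
  equalCoef b (⊙-zeroˡ x) = do
    d ← decide b x
    pure (d , tt , F.zeroˡ _)
  equalCoef b (⊙-distribʳ x a a′) = do
    d ← decide b x
    pure (d , (d , d) , F.distribʳ _ _ _)
  equalCoef b (⊙-distribˡ a x y) = do
    d ← decide b x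
    e ← decide b y
    pure ((d , e) , (d , e) , F.distribˡ _ _ _)
  equalCoef b (⊙-identityˡ x) = do
    d ← decide b x
    pure (d , d , F.*-identityˡ _)
  equalCoef b (⊙-assoc a a′ x) = do
    d ← decide b x
    pure (d , d , F.*-assoc _ _ _)
  equalCoef b ([]-cong {c} {c′} c≃c′) = do
    d ← ¬¬-excluded-middle {A = b ≃ c}
    e ← ¬¬-excluded-middle {A = b ≃ c′}
    pure (d , e , δ-⇔ d e (λ p → B.trans p c≃c′) (λ p → B.trans p (B.sym c≃c′)))

  -- Double negation remains although both terms are decided, since a derivation may pass through
  -- basis elements that occur in neither.
  coef-cong : ∀ b {x y} → x ≈ᵗ y → ∀ d e → ¬ ¬ coef b x d ≈ˢ coef b y e
  coef-cong b {x} {y} x≈y d e = do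
    d′ , e′ , eq ← equalCoef b x≈y
    pure (F.trans (coef-irrelevant b x d d′) (F.trans eq (coef-irrelevant b y e′ e)))

  module Delete {m} (os : Fin m → Basis) (distinct : ∀ {i j} → os i ≃ os j → i ≡ j) where

    Hit : Basis → Set ℓ
    Hit b = ∃[ i ] os i ≃ b

    HitsDecided : Term → Set ℓ
    HitsDecided = Leafwise (Dec ∘ Hit)

    delete : ∀ x → HitsDecided x → Term
    delete 0ᵗ      _         = 0ᵗ
    delete (x ⊕ y) (h , h′)  = delete x h ⊕ delete y h′
    delete (a ⊙ x) h         = a ⊙ delete x h
    delete [ b ]   (yes _)   = 0ᵗ
    delete [ b ]   (no _)    = [ b ]

    -- A hit at index j settles `os i ≃ b` for all i at once: by distinctness it holds exactly when
    -- i = j.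
    decided : ∀ x → HitsDecided x → ∀ i → Decided (os i) x
    decided 0ᵗ      _        i = tt
    decided (x ⊕ y) (h , h′) i = decided x h i , decided y h′ i
    decided (a ⊙ x) h        i = decided x h i
    decided [ b ]   h        i = leaf h
      where
      leaf : Dec (Hit b) → Dec (os i ≃ b)
      leaf (yes (j , q)) = map′ (λ { ≡.refl → q }) (λ p → distinct (B.trans p (B.sym q))) (i ≟ j)
      leaf (no ¬hit)     = no λ p → ¬hit (i , p)

    coef-delete-hit : ∀ {b} → Hit b → ∀ x h d → coef b (delete x h) d ≈ˢ 0#
    coef-delete-hit hit 0ᵗ      _        _        = F.refl
    coef-delete-hit hit (x ⊕ y) (h , h′) (d , d′) = F.trans
      (F.+-cong (coef-delete-hit hit x h d) (coef-delete-hit hit y h′ d′)) (F.+-identityˡ 0#)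
    coef-delete-hit hit (a ⊙ x) h        d        = F.trans
      (F.*-congˡ (coef-delete-hit hit x h d)) (F.zeroʳ a)
    coef-delete-hit hit [ b′ ]  (yes _)  _        = F.refl
    coef-delete-hit hit [ b′ ]  (no ¬hit) (no _)  = F.refl
    coef-delete-hit (i , q) [ b′ ] (no ¬hit) (yes p) = contradiction (i , B.trans q p) ¬hit

    -- At a deleted leaf the missing decision is negative, since that leaf belongs to the family and
    -- b does not.
    restore : ∀ {b} → ¬ Hit b → ∀ x h → Decided b (delete x h) → Decided b x
    restore ¬hit 0ᵗ      _             _        = tt
    restore ¬hit (x ⊕ y) (h , h′)      (d , d′) = restore ¬hit x h d , restore ¬hit y h′ d′
    restore ¬hit (a ⊙ x) h             d        = restore ¬hit x h d
    restore ¬hit [ b′ ]  (yes (i , q)) _        = no λ p → ¬hit (i , B.trans q (B.sym p))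
    restore ¬hit [ b′ ]  (no _)        d        = d

    coef-restore : ∀ {b} (¬hit : ¬ Hit b) x h d →
                   coef b (delete x h) d ≈ˢ coef b x (restore ¬hit x h d)
    coef-restore ¬hit 0ᵗ      _        _        = F.refl
    coef-restore ¬hit (x ⊕ y) (h , h′) (d , d′) =
      F.+-cong (coef-restore ¬hit x h d) (coef-restore ¬hit y h′ d′)
    coef-restore ¬hit (a ⊙ x) h        d        = F.*-congˡ (coef-restore ¬hit x h d)
    coef-restore ¬hit [ b′ ]  (yes _)  _        = F.refl
    coef-restore ¬hit [ b′ ]  (no _)   d        = F.refl

    delete-leaves : ∀ {b bs} → Hit b → ∀ x h →
                    Leafwise (_∈ₗ b ∷ bs) x → Leafwise (_∈ₗ bs) (delete x h)
    delete-leaves hit 0ᵗ      _         _                = tt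
    delete-leaves hit (x ⊕ y) (h , h′)  (p , q)          =
      delete-leaves hit x h p , delete-leaves hit y h′ q
    delete-leaves hit (a ⊙ x) h         p                = delete-leaves hit x h p
    delete-leaves hit [ b′ ]  (yes _)   _                = tt
    delete-leaves hit [ b′ ]  (no ¬hit) (here ≡.refl)    = contradiction hit ¬hit
    delete-leaves hit [ b′ ]  (no _)    (there p)        = p

    module _ (N : Module F ℓ ℓ) (φ : Basis → Module.Carrierᴹ N)
             (φ-cong : ∀ {b b′} → b ≃ b′ → Module._≈ᴹ_ N (φ b) (φ b′)) where
      open Module N
      open Eval N φ φ-cong
      open Sum +ᴹ-commutativeMonoid
      open Sums +ᴹ-commutativeMonoid
      open SetoidReasoning ≈ᴹ-setoid

      orbitPart : ∀ x → HitsDecided x → Carrierᴹ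
      orbitPart x h = sum λ i → coef (os i) x (decided x h i) *ₗ φ (os i)

      -- Isolates the contribution of the family, by induction on the term. At a leaf that is hit,
      -- distinctness leaves one summand, equal to the value of φ there.
      eval-delete : ∀ x h → eval x ≈ᴹ eval (delete x h) +ᴹ orbitPart x h
      eval-delete 0ᵗ h = ≈ᴹ-sym (≈ᴹ-trans (+ᴹ-identityˡ _) (sum-≈ε {m} λ i → *ₗ-zeroˡ _))
      eval-delete (x ⊕ y) (h , h′) = begin
        eval x +ᴹ eval y
          ≈⟨ +ᴹ-cong (eval-delete x h) (eval-delete y h′) ⟩
        (eval (delete x h) +ᴹ orbitPart x h) +ᴹ (eval (delete y h′) +ᴹ orbitPart y h′)
          ≈⟨ interchange _ _ _ _ ⟩
        (eval (delete x h) +ᴹ eval (delete y h′)) +ᴹ (orbitPart x h +ᴹ orbitPart y h′)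
          ≈⟨ +ᴹ-congˡ (∑-distrib-+ {m} _ _) ⟨
        (eval (delete x h) +ᴹ eval (delete y h′)) +ᴹ
          sum (λ i → coef (os i) x (decided x h i) *ₗ φ (os i) +ᴹ
                     coef (os i) y (decided y h′ i) *ₗ φ (os i))
          ≈⟨ +ᴹ-congˡ (sum-cong-≋ {m} λ i → *ₗ-distribʳ _ _ _) ⟨
        eval (delete (x ⊕ y) (h , h′)) +ᴹ orbitPart (x ⊕ y) (h , h′) ∎
        where
        open CommutativeSemigroupProperties
          (CommutativeMonoid.commutativeSemigroup +ᴹ-commutativeMonoid) using (interchange)
      eval-delete (a ⊙ x) h = begin
        a *ₗ eval x
          ≈⟨ *ₗ-congˡ (eval-delete x h) ⟩
        a *ₗ (eval (delete x h) +ᴹ orbitPart x h)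
          ≈⟨ *ₗ-distribˡ _ _ _ ⟩
        a *ₗ eval (delete x h) +ᴹ a *ₗ orbitPart x h
          ≈⟨ +ᴹ-congˡ (sum-homo (a *ₗ_) (*ₗ-zeroʳ a) (*ₗ-distribˡ a) {m} _) ⟩
        a *ₗ eval (delete x h) +ᴹ sum (λ i → a *ₗ (coef (os i) x (decided x h i) *ₗ φ (os i)))
          ≈⟨ +ᴹ-congˡ (sum-cong-≋ {m} λ i → *ₗ-assoc _ _ _) ⟨
        eval (delete (a ⊙ x) h) +ᴹ orbitPart (a ⊙ x) h ∎
      eval-delete [ b ] h@(no ¬hit) = ≈ᴹ-sym (≈ᴹ-trans
        (+ᴹ-congˡ (sum-≈ε {m} λ i → *ₗ-zeroˡ _)) (+ᴹ-identityʳ _))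
      eval-delete [ b ] h@(yes (j , q)) = ≈ᴹ-sym (begin
        0ᴹ +ᴹ orbitPart [ b ] h               ≈⟨ +ᴹ-identityˡ _ ⟩
        orbitPart [ b ] h                     ≈⟨ sum-single j other ⟩
        δ (decided [ b ] h j) *ₗ φ (os j)     ≈⟨ *ₗ-congʳ (δ-⇔ (decided [ b ] h j) (yes q) id id) ⟩
        1# *ₗ φ (os j)                        ≈⟨ *ₗ-identityˡ _ ⟩
        φ (os j)                              ≈⟨ φ-cong q ⟩
        φ b                                   ∎)
        where
        other : ∀ i → i ≢ j → δ (decided [ b ] h i) *ₗ φ (os i) ≈ᴹ 0ᴹ
        other i i≢j = ≈ᴹ-trans (*ₗ-congʳ (δ-⇔ (decided [ b ] h i) (no i≢j)
          (λ p → distinct (B.trans p (B.sym q))) (λ { ≡.refl → q }))) (*ₗ-zeroˡ _)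

-- Permutation representations

module PermutationRep {ℓ o} (F : CommutativeRing ℓ ℓ) (G : TopologicalGroup ℓ o)
                      {W : Set ℓ} (H : W → Subgroup (TopologicalGroup.group G))
                      (open-H : ∀ w → TopologicalGroup.Open G (Mem (H w))) where
  open TopologicalGroup G
  open Cosets group
  open Topology G
  private module F = CommutativeRing F
  open import Algebra.Properties.Group group using (\\-leftDividesʳ)

  -- The disjoint union of the G / H w over w ∈ W.
  basis : Setoid ℓ ℓ
  basis = record
    { Carrier       = W × Carrier
    ; _≈_           = λ (w , g) (w′ , g′) → w ≡ w′ × g ∼[ H w ] g′
    ; isEquivalence = record
      { refl  = λ {(w , _)} → ≡.refl , ∼-refl (H w)
      ; sym   = λ { {w , _} (≡.refl , p) → ≡.refl , ∼-sym (H w) p }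
      ; trans = λ { {w , _} (≡.refl , p) (≡.refl , q) → ≡.refl , ∼-trans (H w) p q }
      }
    }

  open Setoid basis public
    using () renaming (Carrier to Basis; _≈_ to _≃_; sym to ≃-sym; trans to ≃-trans)
  open FreeModule F basis public

  act : Carrier → Basis → Basis
  act h (w , g) = w , h ∙ g

  act-cong : ∀ h {b b′} → b ≃ b′ → act h b ≃ act h b′
  act-cong h {w , _} (≡.refl , p) = ≡.refl , ∙-∼ (H w) h p

  act-congʳ : ∀ {h h′} b → h ≈ h′ → act h b ≃ act h′ b
  act-congʳ (w , g) h≈h′ = ≡.refl , ≈⇒∼ (H w) (∙-congʳ h≈h′)

  act-∙ : ∀ h h′ b → act (h ∙ h′) b ≃ act h (act h′ b)
  act-∙ h h′ (w , g) = ≡.refl , ≈⇒∼ (H w) (assoc h h′ g)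

  act-ε : ∀ b → act ε b ≃ b
  act-ε (w , g) = ≡.refl , ≈⇒∼ (H w) (identityˡ g)

  act-⁻¹ : ∀ h b → act (h ⁻¹) (act h b) ≃ b
  act-⁻¹ h (w , g) = ≡.refl , ≈⇒∼ (H w) (\\-leftDividesʳ h g)

  private
    module Act g = Eval freeModule (λ b → [ act g b ]) (λ p → []-cong (act-cong g p))

  actᵗ : Carrier → Term → Term
  actᵗ g = Act.eval g

  actᵗ-congʳ : ∀ {g h} x → g ≈ h → actᵗ g x ≈ᵗ actᵗ h x
  actᵗ-congʳ 0ᵗ      p = reflᵗ
  actᵗ-congʳ (x ⊕ y) p = ⊕-cong (actᵗ-congʳ x p) (actᵗ-congʳ y p)
  actᵗ-congʳ (a ⊙ x) p = ⊙-cong (F.refl) (actᵗ-congʳ x p)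
  actᵗ-congʳ [ b ]   p = []-cong (act-congʳ b p)

  actᵗ-ε : ∀ x → actᵗ ε x ≈ᵗ x
  actᵗ-ε 0ᵗ      = reflᵗ
  actᵗ-ε (x ⊕ y) = ⊕-cong (actᵗ-ε x) (actᵗ-ε y)
  actᵗ-ε (a ⊙ x) = ⊙-cong (F.refl) (actᵗ-ε x)
  actᵗ-ε [ b ]   = []-cong (act-ε b)

  actᵗ-∙ : ∀ g h x → actᵗ (g ∙ h) x ≈ᵗ actᵗ g (actᵗ h x)
  actᵗ-∙ g h 0ᵗ      = reflᵗ
  actᵗ-∙ g h (x ⊕ y) = ⊕-cong (actᵗ-∙ g h x) (actᵗ-∙ g h y)
  actᵗ-∙ g h (a ⊙ x) = ⊙-cong (F.refl) (actᵗ-∙ g h x)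
  actᵗ-∙ g h [ b ]   = []-cong (act-∙ g h b)

  fix : Term → Subgroup group
  fix = pointStabiliser (record { isEquivalence = Module.≈ᴹ-isEquivalence freeModule })
    actᵗ (λ g → Act.eval-cong g) actᵗ-congʳ actᵗ-ε actᵗ-∙

  -- The stabiliser of a term contains the intersection of the open stabilisers of its finitely many
  -- leaves.
  open-fix : ∀ x → Open (Mem (fix x))
  open-fix 0ᵗ            = open-resp-≐ ((λ _ → reflᵗ) , λ _ → tt) open-⊤
  open-fix (x ⊕ y)       = open-⊇ (fix (x ⊕ y)) (fix x ⊓ fix y) (open-∩ (open-fix x) (open-fix y))
    λ (p , q) → ⊕-cong p q
  open-fix (a ⊙ x)       = open-⊇ (fix (a ⊙ x)) (fix x) (open-fix x) (⊙-cong (F.refl))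
  open-fix b@([ w , g ]) = open-⊇ (fix b) (stab (H w) g) (open-stab (H w) (open-H w) g)
    λ p → []-cong (≡.refl , ∼-sym (H w) p)

  smoothRep : SmoothRep F G
  smoothRep = record
    { V        = freeModule
    ; _·_      = actᵗ
    ; ·-congʳ  = actᵗ-congʳ
    ; ·-linear = λ g → Act.eval-linear g
    ; ε-·      = actᵗ-ε
    ; ∙-·      = actᵗ-∙
    ; smooth   = open-fix
    }

  module _ (N : SmoothRep F G) (φ : Basis → SmoothRep.Carrierᴹ N)
           (φ-cong : ∀ {b b′} → b ≃ b′ → SmoothRep._≈ᴹ_ N (φ b) (φ b′))
           (φ-act : ∀ g b → SmoothRep._≈ᴹ_ N (φ (act g b)) (SmoothRep._·_ N g (φ b))) where
    open SmoothRep N using (V; _≈ᴹ_; ≈ᴹ-trans; ≈ᴹ-sym; _·_; ·-linear)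
    open Eval V φ φ-cong

    eval-equivariant : ∀ g x → eval (actᵗ g x) ≈ᴹ g · eval x
    eval-equivariant g 0ᵗ      = ≈ᴹ-sym (0ᴹ-homo)
      where open ModuleMorphisms.IsModuleHomomorphism (·-linear g)
    eval-equivariant g (x ⊕ y) = ≈ᴹ-trans
      (SmoothRep.+ᴹ-cong N (eval-equivariant g x) (eval-equivariant g y)) (≈ᴹ-sym (+ᴹ-homo _ _))
      where open ModuleMorphisms.IsModuleHomomorphism (·-linear g)
    eval-equivariant g (a ⊙ x) = ≈ᴹ-trans
      (SmoothRep.*ₗ-congˡ N (eval-equivariant g x)) (≈ᴹ-sym (*ₗ-homo _ _))
      where open ModuleMorphisms.IsModuleHomomorphism (·-linear g)
    eval-equivariant g [ b ]   = φ-act g b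

    evalHom : Hom F G smoothRep N
    evalHom = record { ⟦_⟧ = eval ; linear = eval-linear ; equivariant = eval-equivariant }

  module _ (J : Subgroup group) where
    open Subgroup J using (∙-closed; ⁻¹-closed)

    -- The form of invariance carried through the induction. Deletion acts on the syntax of a term,
    -- and its effect on coefficients is a simple case split.
    CoefInvariant : Term → Set ℓ
    CoefInvariant x = ∀ {j} → j ∈ Mem J → ∀ b d e →
      ¬ ¬ coef b x d F.≈ coef (act j b) x e

    Invariant : Term → Set ℓ
    Invariant x = ∀ {j} → j ∈ Mem J → actᵗ j x ≈ᵗ x

    act-decided : ∀ j {b} x → Decided b x → Decided (act j b) (actᵗ j x)
    act-decided j 0ᵗ      _       = tt
    act-decided j (x ⊕ y) (d , e) = act-decided j x d , act-decided j y e
    act-decided j (a ⊙ x) d       = act-decided j x d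
    act-decided j [ b ]   d       = map′ (act-cong j) (act-cancel j) d
      where
      act-cancel : ∀ j {b b′} → act j b ≃ act j b′ → b ≃ b′
      act-cancel j p = ≃-trans (≃-sym (act-⁻¹ j _)) (≃-trans (act-cong (j ⁻¹) p) (act-⁻¹ j _))

    coef-act : ∀ j {b} x d → coef b x d F.≈ coef (act j b) (actᵗ j x) (act-decided j x d)
    coef-act j 0ᵗ      _       = F.refl
    coef-act j (x ⊕ y) (d , e) = F.+-cong (coef-act j x d) (coef-act j y e)
    coef-act j (a ⊙ x) d       = F.*-congˡ (coef-act j x d)
    coef-act j [ b ]   (yes _) = F.refl
    coef-act j [ b ]   (no _)  = F.refl

    -- The coefficient of b in x is that of j b in j x, and j x ≈ x.
    invariant⇒coefInvariant : ∀ x → Invariant x → CoefInvariant x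
    invariant⇒coefInvariant x inv {j} j∈J b d e = do
      eq ← coef-cong (act j b) (inv j∈J) (act-decided j x d) e
      pure (F.trans (coef-act j x d) eq)

    module Orbit (w : W) (g : Carrier) {n} (t : Transversal (Mem J) (stab (H w) g) n) where
      open Transversal t
      b : Basis
      b = w , g

      points : Fin n → Basis
      points i = act (rep i) b

      points-cover : ∀ {j} → j ∈ Mem J → ∃[ i ] points i ≃ act j b
      points-cover j∈J = let i , p = cover j∈J in i , ≡.refl , stab-∼⁺ (H w) g p

      open Delete points (λ (_ , p) → distinct (stab-∼⁻ (H w) g p)) public

      hit : Hit b
      hit = let i , p = points-cover (Subgroup.ε-closed J) in i , ≃-trans p (act-ε b)

      hit-act : ∀ {j b′} → j ∈ Mem J → Hit b′ → Hit (act j b′)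
      hit-act {j} {b′} j∈J (i , p) =
        let k , q = points-cover (∙-closed j∈J (rep∈ i)) in
        k , ≃-trans q (≃-trans (act-∙ j (rep i) b) (act-cong j p))

      hit-act⁻ : ∀ {j b′} → j ∈ Mem J → Hit (act j b′) → Hit b′
      hit-act⁻ {j} {b′} j∈J h =
        let k , q = hit-act (⁻¹-closed j∈J) h in k , ≃-trans q (act-⁻¹ j b′)

      -- The deleted orbit is stable under J, so b′ and j b′ are both deleted, with coefficient 0,
      -- or both untouched.
      delete-coefInvariant : ∀ x h → CoefInvariant x → CoefInvariant (delete x h)
      delete-coefInvariant x h inv {j} j∈J b′ d e = ¬¬-excluded-middle {A = Hit b′} >>= λ where
        (yes hit) → pure (F.trans (coef-delete-hit hit x h d)
          (F.sym (coef-delete-hit (hit-act j∈J hit) x h e)))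
        (no ¬hit) → do
          let ¬hit′ = ¬hit ∘ hit-act⁻ j∈J
          eq ← inv j∈J b′ (restore ¬hit x h d) (restore ¬hit′ x h e)
          pure (F.trans (coef-restore ¬hit x h d) (F.trans eq (F.sym (coef-restore ¬hit′ x h e))))

    module Vanishing (N : Module F ℓ ℓ) (φ : Basis → Module.Carrierᴹ N)
                     (φ-cong : ∀ {b b′} → b ≃ b′ → Module._≈ᴹ_ N (φ b) (φ b′)) where
      open Module N
      open Eval N φ φ-cong
      open Sum +ᴹ-commutativeMonoid
      open Sums +ᴹ-commutativeMonoid

      -- One transversal suffices, which leaves `orbitSum-vanishes` free to choose one adapted to a
      -- tower of subgroups.
      OrbitSumVanishes : Basis → Set ℓ
      OrbitSumVanishes b@(w , g) = ∃[ n ] Σ[ t ∈ Transversal (Mem J) (stab (H w) g) n ]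
        sum (λ i → φ (act (Transversal.rep t i) b)) ≈ᴹ 0ᴹ

      eval-vanishes : (∀ b → ¬ ¬ OrbitSumVanishes b) → ∀ x → Invariant x → ¬ ¬ eval x ≈ᴹ 0ᴹ
      eval-vanishes orbitSum x inv = go (leaves x) x (leaves-∈ x) (invariant⇒coefInvariant x inv)
        where
        -- Coefficients are constant along the orbit of b, so the orbit contributes a
        -- multiple of its sum; deleting it removes b from the leaves.
        go : ∀ bs x → Leafwise (_∈ₗ bs) x → CoefInvariant x → ¬ ¬ eval x ≈ᴹ 0ᴹ
        go []       x in-bs inv = pure (eval-no-leaves N φ φ-cong x in-bs)
        go (b@(w , g) ∷ bs) x in-bs inv = do
          n , t , sum≈0 ← orbitSum b
          let open Orbit w g t hiding (b)
              open Transversal t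
          h ← leafwise {Q = Dec ∘ Hit} (λ _ → ¬¬-excluded-middle) x
          d ← decide b x
          eqs ← ¬¬-sequence λ i → inv (rep∈ i) b d (decided x h i)
          rest≈0 ← go bs (delete x h) (delete-leaves hit x h in-bs) (delete-coefInvariant x h inv)
          pure (≈ᴹ-trans (eval-delete N φ φ-cong x h) (≈ᴹ-trans (+ᴹ-cong rest≈0 (begin
            orbitPart N φ φ-cong x h
              ≈⟨ sum-cong-≋ {n} (λ i → *ₗ-congʳ (eqs i)) ⟨
            sum (λ i → coef b x d *ₗ φ (points i))
              ≈⟨ sum-homo (coef b x d *ₗ_) (*ₗ-zeroʳ _) (*ₗ-distribˡ _) {n} _ ⟨
            coef b x d *ₗ sum (λ i → φ (points i))
              ≈⟨ *ₗ-congˡ sum≈0 ⟩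
            coef b x d *ₗ 0ᴹ
              ≈⟨ *ₗ-zeroʳ _ ⟩
            0ᴹ ∎)) (+ᴹ-identityˡ 0ᴹ)))
          where open SetoidReasoning ≈ᴹ-setoid

-- Constant sums in characteristic p and the cover of a projective representation

module _ {ℓ} {F : CommutativeRing ℓ ℓ} (M : Module F ℓ ℓ) where
  private module F = CommutativeRing F
  open Module M
  open Sum +ᴹ-commutativeMonoid
  open Multiple F.+-rawMonoid using () renaming (_×_ to _·_)

  sum-const : ∀ n v → sum {n} (λ _ → v) ≈ᴹ (n · F.1#) *ₗ v
  sum-const zero    v = ≈ᴹ-sym (*ₗ-zeroˡ v)
  sum-const (suc n) v = ≈ᴹ-trans (+ᴹ-cong (≈ᴹ-sym (*ₗ-identityˡ v)) (sum-const n v))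
    (≈ᴹ-sym (*ₗ-distribʳ v _ _))

  char∣⇒sum-const≈0 : ∀ {p} → HasCharacteristic F p → ∀ {n} → p ∣ n → ∀ v → sum {n} (λ _ → v) ≈ᴹ 0ᴹ
  char∣⇒sum-const≈0 char {n} p∣n v = ≈ᴹ-trans (sum-const n v)
    (≈ᴹ-trans (*ₗ-congʳ (Equivalence.from (char n) p∣n)) (*ₗ-zeroˡ v))

module Projective
  {ℓ o} {p : ℕ} (pr : Prime p) (F : CommutativeRing ℓ ℓ) (char : HasCharacteristic F p)
  (G : TopologicalGroup ℓ o)
  (U : Subgroup (TopologicalGroup.group G)) (open-U : TopologicalGroup.Open G (Mem U))
  (proP : IsProP (induced G U) p)
  (K : Subgroup (TopologicalGroup.group G)) (open-K : TopologicalGroup.Open G (Mem K))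
  (compact : IsCompact (induced G K)) (fair : IsFair G K)
  (P : SmoothRep F G) (v₀ : SmoothRep.Carrierᴹ P)
  where
  open TopologicalGroup G
  open Cosets group
  open Topology G
  open Fairness K compact fair
  open OpenSubgroup
  private module P = SmoothRep P
  open P using (_·_; _≈ᴹ_; ≈ᴹ-refl; ≈ᴹ-sym; ≈ᴹ-trans)
  open Sum P.+ᴹ-commutativeMonoid
  open Sums P.+ᴹ-commutativeMonoid
  private module Lin g = ModuleMorphisms.IsModuleHomomorphism (P.·-linear g)

  Stab : P.Carrierᴹ → Subgroup group
  Stab = pointStabiliser P.≈ᴹ-setoid _·_ (λ g → Lin.⟦⟧-cong g) P.·-congʳ P.ε-· P.∙-·

  -- `Stab v₀` makes the image of v₀ under a section invariant, compactness of `K` yields finite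
  -- transversals of J, and `U` makes indices inside J powers of p.
  J : Subgroup group
  J = Stab v₀ ⊓ K ⊓ U

  open-J : Open (Mem J)
  open-J = open-∩ (P.smooth v₀) (open-∩ open-K open-U)

  J⊆K : Mem J ⊆ Mem K
  J⊆K (_ , j∈K , _) = j∈K

  H : P.Carrierᴹ → OpenSubgroup
  H w = record { subgroup = Stab w ⊓ K ; isOpen = open-∩ (P.smooth w) open-K ; ⊆K = proj₂ }

  H′ : P.Carrierᴹ → OpenSubgroup
  H′ w = proj₁ (fair-⊓ J open-J (H w))

  H′⊆H : ∀ w → Mem (subgroup (H′ w)) ⊆ Mem (subgroup (H w))
  H′⊆H w = proj₁ (proj₂ (fair-⊓ J open-J (H w)))

  open PermutationRep F G (subgroup ∘ H′) (isOpen ∘ H′)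

  φ : Basis → P.Carrierᴹ
  φ (w , g) = g · w

  -- Stated for H rather than H′: besides making φ well defined, it shows in `orbit-S` that φ does
  -- not separate cosets of H′ inside one coset of H.
  H-cong : ∀ w {g g′} → g ∼[ subgroup (H w) ] g′ → g · w ≈ᴹ g′ · w
  H-cong w {g} {g′} (fixes , _) = ≈ᴹ-trans (Lin.⟦⟧-cong g (≈ᴹ-sym fixes))
    (≈ᴹ-trans (≈ᴹ-sym (P.∙-· g _ w)) (P.·-congʳ w (\\-leftDividesˡ g g′)))
    where open import Algebra.Properties.Group group using (\\-leftDividesˡ)

  φ-cong : ∀ {b b′} → b ≃ b′ → φ b ≈ᴹ φ b′
  φ-cong {w , _} (≡.refl , p) = H-cong w (H′⊆H w p)

  cover : Hom F G smoothRep P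
  cover = evalHom P φ φ-cong λ { g (w , h) → P.∙-· g h w }

  -- The basis element `[ w , ε ]` maps to ε · w = w, so f and h are compared at w directly.
  cover-epi : IsEpi F G cover
  cover-epi {Q} f h f∘e≗h∘e w = begin
    f.⟦ w ⟧              ≈⟨ F.⟦⟧-cong (P.ε-· w) ⟨
    f.⟦ ε · w ⟧          ≈⟨ f∘e≗h∘e [ w , ε ] ⟩
    h.⟦ ε · w ⟧          ≈⟨ H.⟦⟧-cong (P.ε-· w) ⟩
    h.⟦ w ⟧              ∎
    where
    module f = Hom f
    module h = Hom h
    module F = ModuleMorphisms.IsModuleHomomorphism f.linear
    module H = ModuleMorphisms.IsModuleHomomorphism h.linear
    open SetoidReasoning (SmoothRep.≈ᴹ-setoid Q)

  idₕ : Hom F G P P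
  idₕ = record
    { ⟦_⟧         = id
    ; linear      = isModuleHomomorphism P.rawModule ≈ᴹ-refl
    ; equivariant = λ _ _ → ≈ᴹ-refl
    }
    where open import Algebra.Module.Morphism.Construct.Identity using (isModuleHomomorphism)

  open Vanishing J P.V φ φ-cong

  -- The J-orbit of g H′ sums to Σ_r [S : T] r g w with r running over J / S,
  -- where S and T are the stabilisers in J of g H and g H′.
  orbitSum-vanishes : ∀ b → ¬ ¬ OrbitSumVanishes b
  orbitSum-vanishes b@(w , g) = do
    n , Y , p∣n ← proP-index pr U S T open-U proP open-T T⊆S (λ (j , _) → proj₂ (proj₂ j))
      (λ S⊆T → proj₂ (proj₂ (fair-⊓ J open-J (H w))) g (λ s → proj₂ (S⊆T s)))
    m , R ← transversal J S (FiniteIndex-⊆ J K S J⊆K (compact⇒FiniteIndex K S compact open-S))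
    pure (m * n ,
      transversal-⊓ J (stab (subgroup (H′ w)) g) (transversal-* J S T proj₁ T⊆S R Y) ,
      sum≈0 R Y p∣n)
    where
    S = J ⊓ stab (subgroup (H w)) g
    T = J ⊓ stab (subgroup (H′ w)) g
    T⊆S : Mem T ⊆ Mem S
    T⊆S (j , t) = j , H′⊆H w t
    open-S : Open (Mem S)
    open-S = open-∩ open-J (open-stab (subgroup (H w)) (isOpen (H w)) g)
    open-T : Open (Mem T)
    open-T = open-∩ open-J (open-stab (subgroup (H′ w)) (isOpen (H′ w)) g)

    sum≈0 : ∀ {m n} (R : Transversal (Mem J) S m) (Y : Transversal (Mem S) T n) → p ∣ n →
            sum (λ k → φ (act (Transversal.rep (transversal-* J S T proj₁ T⊆S R Y) k) b)) ≈ᴹ P.0ᴹ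
    sum≈0 {m} {n} R Y p∣n = begin
      sum (λ k → φ (act (Transversal.rep (transversal-* J S T proj₁ T⊆S R Y) k) b))
        ≈⟨ sum-remQuot m n (λ (i , j) → φ (act (R.rep i ∙ Y.rep j) b)) ⟩
      sum (λ i → sum (λ j → φ (act (R.rep i ∙ Y.rep j) b)))
        ≈⟨ sum-cong-≋ {m} (λ i → sum-cong-≋ {n} (λ j → orbit-S i j)) ⟩
      sum (λ i → sum {n} (λ _ → R.rep i · g · w))
        ≈⟨ sum-≈ε {m} (λ i → char∣⇒sum-const≈0 P.V char p∣n _) ⟩
      P.0ᴹ ∎
      where
      module R = Transversal R
      module Y = Transversal Y
      open SetoidReasoning P.≈ᴹ-setoid
      -- `Y.rep j` lies in g H g⁻¹ and H fixes w, so it fixes g · w; the inner sum thus has n equal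
      -- terms, with p dividing n.
      orbit-S : ∀ i j → φ (act (R.rep i ∙ Y.rep j) b) ≈ᴹ R.rep i · g · w
      orbit-S i j = begin
        ((R.rep i ∙ Y.rep j) ∙ g) · w    ≈⟨ P.·-congʳ w (assoc _ _ _) ⟩
        (R.rep i ∙ (Y.rep j ∙ g)) · w    ≈⟨ P.∙-· _ _ w ⟩
        R.rep i · (Y.rep j ∙ g) · w      ≈⟨ Lin.⟦⟧-cong (R.rep i) (H-cong w (proj₂ (Y.rep∈ j))) ⟨
        R.rep i · g · w                  ∎

  projective⇒¬¬≈0 : IsProjective F G P → ¬ ¬ v₀ ≈ᴹ P.0ᴹ
  projective⇒¬¬≈0 projective = do
    let s , section = projective cover cover-epi idₕ
        module s = Hom s
        module S = ModuleMorphisms.IsModuleHomomorphism s.linear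
    x≈0 ← eval-vanishes orbitSum-vanishes s.⟦ v₀ ⟧
      (λ {j} (fixes , _) → transᵗ (symᵗ (s.equivariant j v₀)) (S.⟦⟧-cong fixes))
    pure (≈ᴹ-trans (≈ᴹ-sym (section v₀)) x≈0)

theorem1p2 : ∀ {ℓ o} (p : ℕ) → 0 < p →
    (F : CommutativeRing ℓ ℓ) → IsField F → HasCharacteristic F p →
    (G : TopologicalGroup ℓ o) → IsLocallyProP G p →
    (K : Subgroup (TopologicalGroup.group G)) →
    TopologicalGroup.Open G (Mem K) →
    IsProfinite (induced G K) →
    IsFair G K →
    ¬ (Σ[ P ∈ SmoothRep F G ] IsProjective F G P × IsNonzero F G P)
theorem1p2 p 0<p F isField char G (U , open-U , proP) K open-K profinite fair
    (P , projective , v₀ , v₀≉0) =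
  Projective.projective⇒¬¬≈0 (char-prime F 0<p isField char) F char G U open-U proP
    K open-K (IsProfinite.compact profinite) fair P v₀ projective v₀≉0
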